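{- Let $\mathcal S=\{s_1,\dots,s_r\}\subseteq\{\pm1\}^n$ be a set of sign vectors. The following are equivalent: (1) The family $\mathcal S$ of sign vectors is Schur independent. (2) The set $\mathcal F=\operatorname{conv}\{ss^{\mathsf t}:s\in\mathcal S\}$ is a simplicial face of the elliptope $\mathcal E_n$. Either condition implies that each correlation matrix in the relative interior of $\mathcal F$ has a unique sign component decomposition.
   Context: $\mathbb{H}_n$ is the space of real symmetric $n\times n$ matrices; $\mathbf e$ is the all-ones vector; $\mathrm{diag}(X)$ is the vector of diagonal entries of $X$; $\odot$ is the entrywise product of vectors; ${}^{\mathsf t}$ is the transpose. A correlation matrix is a positive-semidefinite matrix with unit diagonal. The elliptope is $\mathcal E_n=\{X\in\mathbb{H}_n:\mathrm{diag}(X)=\mathbf e,\ X\succcurlyeq0\}$. A face of a closed convex set $\mathcal K$ is a convex subset $\mathcal F\subseteq\mathcal K$ such that $x,y\in\mathcal K$ and $\tau x+(1-\tau)y\in\mathcal F$ for some $\tau\in(0,1)$ imply $x,y\in\mathcal F$. A simplex is the convex hull of an affinely independent point set; a simplicial face is a face that is also a simplex. A set $\{s_1,\dots,s_r\}\subseteq\{\pm1\}^n$ is Schur independent if $\dim\operatorname{span}\{s_i\odot s_j:1\le i,j\le r\}=\binom r2+1$; equivalently, the family $\{\mathbf e\}\cup\{s_i\odot s_j:1\le i<j\le r\}$ is linearly independent. A sign component decomposition of a correlation matrix $A$ is a representation $A=\sum_{i=1}^m\tau_is_is_i^{\mathsf t}$ for some natural number $m$, with $\tau_i>0$, $\sum_i\tau_i=1$,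 $s_i\in\{\pm1\}^n$, and the matrices $s_is_i^{\mathsf t}$ pairwise distinct. It is unique if any two such representations of $A$ (with any numbers of terms) have the same number of terms and the pairs $(\tau_i,s_i)$ coincide up to permutation and sign flips $s_i\mapsto\pm s_i$.
   Formalization: (2)⇒(1) is stated only when no s_i equals −s_j: for S={s,−s} the hull is the single vertex ss^t, a simplicial face, but the span has dimension 1, not 2. Also n≥1 and r≥1 are assumed. -}

module Defs where

open import Level using (0ℓ; suc)
open import Algebra.Bundles using (CommutativeRing)
import Algebra.Properties.CommutativeMonoid.Sum as Sum
open import Data.Fin.Base using (Fin)
open import Data.Fin.Permutation using (Permutation; _⟨$⟩ʳ_)
open import Data.Nat.Base as ℕ using (ℕ)
open import Data.Nat.Combinatorics using (_C_)
open import Data.Product.Base using (Σ; ∃; Σ-syntax; ∃-syntax; _×_; _,_)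
open import Data.Sign.Base as Sign using (Sign)
open import Data.Sum.Base using (_⊎_)
open import Data.Vec.Base as Vec using (Vec; lookup)
open import Relation.Binary.Construct.StrictToNonStrict as ToNonStrict using ()
open import Relation.Binary.Core using (Rel)
open import Relation.Binary.Structures using (IsStrictTotalOrder)
open import Relation.Binary.PropositionalEquality.Core using (_≡_; _≢_)
open import Relation.Nullary.Negation.Core using (¬_)
open import Relation.Unary using (Pred; _∈_; _⊆_; _≐_)

-- The real numbers, given by the classical axioms that determine them up to
-- isomorphism: a nontrivial, totally ordered field in which every nonempty
-- subset that is bounded above has a least upper bound.
record RealNumbers : Set (suc 0ℓ) where
  field
    commutativeRing : CommutativeRing 0ℓ 0ℓ

  open CommutativeRing commutativeRing public

  infix 4 _<_ _≤_
  field
    _<_                : Rel Carrier 0ℓ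
    isStrictTotalOrder : IsStrictTotalOrder _≈_ _<_
    0≉1                : ¬ (0# ≈ 1#)
    inverse            : ∀ x → ¬ (x ≈ 0#) → ∃[ y ] x * y ≈ 1#
    +-monoʳ-<          : ∀ z {x y} → x < y → z + x < z + y
    *-pos              : ∀ {x y} → 0# < x → 0# < y → 0# < x * y

  _≤_ : Rel Carrier 0ℓ
  _≤_ = ToNonStrict._≤_ _≈_ _<_

  UpperBound : Pred Carrier 0ℓ → Pred Carrier 0ℓ
  UpperBound P u = ∀ x → x ∈ P → x ≤ u

  field
    supremum : (P : Pred Carrier 0ℓ) → ∃ P → ∃ (UpperBound P) →
               ∃[ u ] (u ∈ UpperBound P × (∀ v → v ∈ UpperBound P → u ≤ v))

SignVector : ℕ → Set
SignVector n = Vec Sign n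

negate : ∀ {n} → SignVector n → SignVector n
negate = Vec.map Sign.opposite

module Geometry (ℝ : RealNumbers) where

  open RealNumbers ℝ
  open Sum +-commutativeMonoid using (sum; sum-syntax)

  -- Coordinate spaces ℝ^I.  Vectors have I = Fin n and matrices
  -- I = Fin n × Fin n, so linear and convex notions are defined once.
  Space : Set → Set
  Space I = I → Carrier

  Matrix : ℕ → Set
  Matrix n = Space (Fin n × Fin n)

  infix 4 _≋_
  _≋_ : ∀ {I} → Rel (Space I) 0ℓ
  x ≋ y = ∀ a → x a ≈ y a

  𝟘 : ∀ {I} → Space I
  𝟘 _ = 0#

  combination : ∀ {I k} → (Fin k → Carrier) → (Fin k → Space I) → Space I
  combination {k = k} c p a = ∑[ i < k ] (c i * p i a)

  mix : ∀ {I} → Carrier → Space I → Space I → Space I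
  mix τ x y a = τ * x a + (1# - τ) * y a

  span : ∀ {I} → Pred (Space I) 0ℓ → Pred (Space I) 0ℓ
  span P x = ∃[ k ] Σ[ p ∈ (Fin k → Space _) ] Σ[ c ∈ (Fin k → Carrier) ]
    ((∀ i → p i ∈ P) × x ≋ combination c p)

  aff : ∀ {I} → Pred (Space I) 0ℓ → Pred (Space I) 0ℓ
  aff P x = ∃[ k ] Σ[ p ∈ (Fin k → Space _) ] Σ[ c ∈ (Fin k → Carrier) ]
    ((∀ i → p i ∈ P) × sum c ≈ 1# × x ≋ combination c p)

  conv : ∀ {I} → Pred (Space I) 0ℓ → Pred (Space I) 0ℓ
  conv P x = ∃[ k ] Σ[ p ∈ (Fin k → Space _) ] Σ[ c ∈ (Fin k → Carrier) ]
    ((∀ i → p i ∈ P) × (∀ i → 0# ≤ c i) × sum c ≈ 1# × x ≋ combination c p)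

  range : ∀ {I} {J : Set} → (J → Space I) → Pred (Space I) 0ℓ
  range p x = ∃[ j ] x ≋ p j

  LinearlyIndependent : ∀ {I k} → (Fin k → Space I) → Set
  LinearlyIndependent p = ∀ c → combination c p ≋ 𝟘 → ∀ i → c i ≈ 0#

  AffinelyIndependent : ∀ {I k} → (Fin k → Space I) → Set
  AffinelyIndependent p =
    ∀ c → sum c ≈ 0# → combination c p ≋ 𝟘 → ∀ i → c i ≈ 0#

  -- The subspace W has dimension d: it has a basis of d vectors.
  HasDimension : ∀ {I} → Pred (Space I) 0ℓ → ℕ → Set
  HasDimension W d =
    Σ[ b ∈ (Fin d → Space _) ] (LinearlyIndependent b × span (range b) ≐ W)

  Convex : ∀ {I} → Pred (Space I) 0ℓ → Set
  Convex K = ∀ x y τ → x ∈ K → y ∈ K → 0# ≤ τ → τ ≤ 1# → mix τ x y ∈ K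

  record IsFace {I} (K F : Pred (Space I) 0ℓ) : Set where
    field
      subset  : F ⊆ K
      convex  : Convex F
      extreme : ∀ x y τ → x ∈ K → y ∈ K → 0# < τ → τ < 1# →
                mix τ x y ∈ F → x ∈ F × y ∈ F

  IsSimplex : ∀ {I} → Pred (Space I) 0ℓ → Set
  IsSimplex F =
    ∃[ k ] Σ[ p ∈ (Fin k → Space _) ] (AffinelyIndependent p × F ≐ conv (range p))

  IsSimplicialFace : ∀ {I} → Pred (Space I) 0ℓ → Pred (Space I) 0ℓ → Set
  IsSimplicialFace K F = IsFace K F × IsSimplex F

  -- Squared Frobenius distance.
  dist² : ∀ {n} → Matrix n → Matrix n → Carrier
  dist² {n} x y =
    ∑[ i < n ] ∑[ j < n ] ((x (i , j) - y (i , j)) * (x (i , j) - y (i , j)))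

  -- Interior relative to the affine hull.
  relint : ∀ {n} → Pred (Matrix n) 0ℓ → Pred (Matrix n) 0ℓ
  relint F x = x ∈ F ×
    ∃[ ε ] (0# < ε × (∀ y → y ∈ aff F → dist² x y < ε * ε → y ∈ F))

  Symmetric : ∀ {n} → Pred (Matrix n) 0ℓ
  Symmetric X = ∀ i j → X (i , j) ≈ X (j , i)

  UnitDiagonal : ∀ {n} → Pred (Matrix n) 0ℓ
  UnitDiagonal X = ∀ i → X (i , i) ≈ 1#

  PositiveSemidefinite : ∀ {n} → Pred (Matrix n) 0ℓ
  PositiveSemidefinite {n} X = (v : Space (Fin n)) →
    0# ≤ ∑[ i < n ] ∑[ j < n ] (v i * X (i , j) * v j)

  -- Its members are exactly the n × n correlation matrices.
  Elliptope : ∀ n → Pred (Matrix n) 0ℓ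
  Elliptope n X = Symmetric X × UnitDiagonal X × PositiveSemidefinite X

  ⟦_⟧ˢ : Sign → Carrier
  ⟦ Sign.+ ⟧ˢ = 1#
  ⟦ Sign.- ⟧ˢ = - 1#

  ⟦_⟧ : ∀ {n} → SignVector n → Space (Fin n)
  ⟦ s ⟧ a = ⟦ lookup s a ⟧ˢ

  infixl 7 _⊙_
  _⊙_ : ∀ {I} → Space I → Space I → Space I
  (x ⊙ y) a = x a * y a

  outer : ∀ {n} → SignVector n → Matrix n
  outer s (a , b) = ⟦ s ⟧ a * ⟦ s ⟧ b

  schurProducts : ∀ {n r} → (Fin r → SignVector n) → Fin r × Fin r → Space (Fin n)
  schurProducts s (i , j) = ⟦ s i ⟧ ⊙ ⟦ s j ⟧

  SchurIndependent : ∀ {n r} → (Fin r → SignVector n) → Set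
  SchurIndependent {r = r} s =
    HasDimension (span (range (schurProducts s))) (r C 2 ℕ.+ 1)

  cutHull : ∀ {n r} → (Fin r → SignVector n) → Pred (Matrix n) 0ℓ
  cutHull s = conv (range (λ i → outer (s i)))

  record SignDecomposition {n} (A : Matrix n) : Set where
    field
      terms    : ℕ
      weight   : Fin terms → Carrier
      vector   : Fin terms → SignVector n
      positive : ∀ i → 0# < weight i
      total    : sum weight ≈ 1#
      distinct : ∀ i j → i ≢ j → ¬ (outer (vector i) ≋ outer (vector j))
      equation : A ≋ combination weight (λ i → outer (vector i))

  open SignDecomposition

  SameDecomposition : ∀ {n} {A : Matrix n} → Rel (SignDecomposition A) 0ℓ
  SameDecomposition D E =
    terms D ≡ terms E ×
    Σ[ π ∈ Permutation (terms D) (terms E) ] (∀ i →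
      weight D i ≈ weight E (π ⟨$⟩ʳ i) ×
      (vector D i ≡ vector E (π ⟨$⟩ʳ i) ⊎ vector D i ≡ negate (vector E (π ⟨$⟩ʳ i))))

  HasUniqueSignDecomposition : ∀ {n} → Matrix n → Set
  HasUniqueSignDecomposition A =
    SignDecomposition A × (∀ (D E : SignDecomposition A) → SameDecomposition D E)

{-# OPTIONS --safe #-}

-- (1) ⇒ (2): if a mixture of X, Y ∈ 𝓔ₙ lies in 𝓕, then X vanishes on the common
-- orthogonal complement of the sᵢ, so X = Σ Bᵢⱼ sᵢsⱼᵗ with B = (wᵢᵗXwⱼ) for a
-- family w dual to s.  The unit diagonal reads Σ Bᵢⱼ sᵢ⊙sⱼ = 𝐞, and Schur
-- independence forces B to be diagonal with trace 1; psd gives Bᵢᵢ ≥ 0.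
--
-- (2) ⇒ (1): rank-one sign matrices are extreme in 𝓔ₙ, so they are vertices of the
-- simplex 𝓕 and hence affinely independent.  If Δ is a symmetric combination of the
-- sᵢsⱼᵗ with zero diagonal, dominated by a point N of 𝓕, then N ± κΔ ∈ 𝓔ₙ for small κ,
-- and the face property puts both into 𝓕.  A linear relation among the sᵢ, or a
-- relation among the sᵢ⊙sⱼ, would give such a Δ with the wrong coordinates.
--
-- Uniqueness: the terms of a sign decomposition of A ∈ 𝓕 lie in 𝓕 and are extreme,
-- so they are vertices; in the relative interior every barycentric coordinate of A is
-- positive, so the terms are all the vertices, weighted by those coordinates.
module Submission where

open import Defs
open import Algebra.Bundles using (CommutativeRing)
import Algebra.Properties.Ring as RingProperties
import Algebra.Properties.Semiring.Mult.TCOptimised as Mult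
import Algebra.Properties.Semiring.Sum as SemiringSum
import Algebra.Solver.Ring
open import Algebra.Solver.Ring.AlmostCommutativeRing
  using (fromCommutativeRing; _-Raw-AlmostCommutative⟶_)
open import Data.Empty using (⊥)
open import Data.Fin.Base using (Fin; zero; suc; punchIn; punchOut; _↑ˡ_; _↑ʳ_; splitAt; fromℕ<)
open import Data.Fin.Permutation as Permutation using (Permutation; permutation)
import Data.Fin.Properties as Fin
open import Data.Integer.Base as ℤ using (ℤ; -[1+_])
import Data.Integer.Properties as ℤ
open import Data.Maybe.Base using (just; nothing)
open import Data.Nat.Base as ℕ using (ℕ; zero; suc; NonZero; >-nonZero⁻¹)
open import Data.Nat.Combinatorics using (_C_; nC1≡n; nCk+nC[k+1]≡[n+1]C[k+1])
import Data.Nat.Properties as ℕ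
open import Data.Product.Base as Product using (∃; _×_; _,_; proj₁; proj₂)
open import Data.Sign.Base as Sign using (Sign)
open import Data.Sum.Base using (_⊎_; inj₁; inj₂)
open import Data.Vec.Base using ([]; _∷_; lookup)
open import Function.Base using (_∘_)
open import Function.Definitions using (Injective)
open import Relation.Binary.Definitions using (tri<; tri≈; tri>)
import Relation.Binary.PropositionalEquality as ≡
open ≡ using (_≡_; _≢_)
import Relation.Binary.Reasoning.Setoid as SetoidReasoning
open import Relation.Binary.Structures using (IsStrictTotalOrder)
open import Relation.Nullary using (¬_; yes; no; contradiction)
open import Relation.Nullary.Decidable using (decidable-stable; ¬?)
open import Relation.Unary using (Pred; _∈_; _⊆_; _≐_)

-- Both implications pass through `SchurFree`, which speaks of coefficient matrices instead of
-- dimensions; a count is the bridge, since as many generators as the dimension must be independent.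
-- Reading the entries of `B` off the matrix `S B Sᵗ` needs a family dual to the sign vectors, so
-- linear independence of the signs precedes the use of Schur relations in both directions. From a
-- face it has to be won separately: there the centre is the mean `N` of the vertices other than
-- `sₖsₖᵗ`, the direction is `N - sₖsₖᵗ`, and that vertex itself is the far end of the segment. For
-- relations among Schur products the centre is the centroid of all vertices, and both ends are
-- perturbations. The admissible κ comes neither from eigenvalues nor from compactness but from a
-- bound on a quadratic form by its coefficients (`form-bounded-below`). Extremality of sign
-- matrices is likewise elementary: it is checked entry by entry, from the form at vectors with two
-- nonzero coordinates.

-- The library's ring solver with integer coefficients, so that terms of
-- opposite sign cancel.
module IntegerRingSolver {c ℓ} (R : CommutativeRing c ℓ) where

  open CommutativeRing R
  open RingProperties ring
  open Mult semiring renaming (_×_ to _×ⁿ_)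
  open SetoidReasoning setoid

  fromℤ : ℤ → Carrier
  fromℤ (ℤ.+ n)    = n ×ⁿ 1#
  fromℤ (-[1+ n ]) = - (suc n ×ⁿ 1#)

  private
    suc-× : ∀ n → suc n ×ⁿ 1# ≈ 1# + n ×ⁿ 1#
    suc-× n = ×-homo-+ 1# 1 n

    -‿cancel-+ : ∀ x y z → x + y - (x + z) ≈ y - z
    -‿cancel-+ x y z = begin
      x + y - (x + z)      ≈⟨ +-congˡ (sym (-‿+-comm x z)) ⟩
      x + y + (- x + - z)  ≈⟨ +-congʳ (+-comm x y) ⟩
      y + x + (- x + - z)  ≈⟨ +-assoc y x _ ⟩
      y + (x + (- x + - z)) ≈⟨ +-congˡ (+-assoc x (- x) (- z)) ⟨
      y + (x - x + - z)    ≈⟨ +-congˡ (+-congʳ (-‿inverseʳ x)) ⟩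
      y + (0# + - z)       ≈⟨ +-congˡ (+-identityˡ _) ⟩
      y - z                ∎

    fromℤ-⊖ : ∀ m n → fromℤ (m ℤ.⊖ n) ≈ m ×ⁿ 1# - n ×ⁿ 1#
    fromℤ-⊖ m       zero    = sym (trans (+-congˡ -0#≈0#) (+-identityʳ _))
    fromℤ-⊖ zero    (suc n) = sym (+-identityˡ _)
    fromℤ-⊖ (suc m) (suc n) = begin
      fromℤ (suc m ℤ.⊖ suc n)                 ≡⟨ ≡.cong fromℤ (ℤ.[1+m]⊖[1+n]≡m⊖n m n) ⟩
      fromℤ (m ℤ.⊖ n)                         ≈⟨ fromℤ-⊖ m n ⟩
      m ×ⁿ 1# - n ×ⁿ 1#                       ≈⟨ -‿cancel-+ 1# _ _ ⟨
      1# + m ×ⁿ 1# - (1# + n ×ⁿ 1#)           ≈⟨ +-cong (suc-× m) (-‿cong (suc-× n)) ⟨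
      suc m ×ⁿ 1# - suc n ×ⁿ 1#               ∎

    fromℤ-+ : ∀ i j → fromℤ (i ℤ.+ j) ≈ fromℤ i + fromℤ j
    fromℤ-+ (ℤ.+ m)  (ℤ.+ n)  = ×-homo-+ 1# m n
    fromℤ-+ (ℤ.+ m)  -[1+ n ] = fromℤ-⊖ m (suc n)
    fromℤ-+ -[1+ m ] (ℤ.+ n)  = trans (fromℤ-⊖ n (suc m)) (+-comm _ _)
    fromℤ-+ -[1+ m ] -[1+ n ] = begin
      - (suc (suc (m ℕ.+ n)) ×ⁿ 1#)     ≡⟨ ≡.cong (λ k → - (k ×ⁿ 1#)) (≡.sym (ℕsuc m n)) ⟩
      - ((suc m ℕ.+ suc n) ×ⁿ 1#)       ≈⟨ -‿cong (×-homo-+ 1# (suc m) (suc n)) ⟩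
      - (suc m ×ⁿ 1# + suc n ×ⁿ 1#)     ≈⟨ -‿+-comm _ _ ⟨
      - (suc m ×ⁿ 1#) + - (suc n ×ⁿ 1#) ∎
      where
      ℕsuc : ∀ m n → suc m ℕ.+ suc n ≡ suc (suc (m ℕ.+ n))
      ℕsuc zero    n = ≡.refl
      ℕsuc (suc m) n = ≡.cong suc (ℕsuc m n)

    fromℤ-neg : ∀ i → fromℤ (ℤ.- i) ≈ - fromℤ i
    fromℤ-neg (ℤ.+ zero)  = sym -0#≈0#
    fromℤ-neg (ℤ.+ suc n) = refl
    fromℤ-neg -[1+ n ]    = sym (-‿involutive _)

    fromℤ-*⁺ : ∀ m n → fromℤ (ℤ.+ m ℤ.* ℤ.+ n) ≈ fromℤ (ℤ.+ m) * fromℤ (ℤ.+ n)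
    fromℤ-*⁺ m n = trans (reflexive (≡.cong fromℤ (≡.sym (ℤ.pos-* m n)))) (×1-homo-* m n)

    fromℤ-*ʳ : ∀ m j → fromℤ (ℤ.+ m ℤ.* j) ≈ fromℤ (ℤ.+ m) * fromℤ j
    fromℤ-*ʳ m (ℤ.+ n)  = fromℤ-*⁺ m n
    fromℤ-*ʳ m -[1+ n ] = begin
      fromℤ (ℤ.+ m ℤ.* -[1+ n ])           ≡⟨ ≡.cong fromℤ (ℤ.neg-distribʳ-* (ℤ.+ m) (ℤ.+ suc n)) ⟨
      fromℤ (ℤ.- (ℤ.+ m ℤ.* ℤ.+ suc n))    ≈⟨ fromℤ-neg (ℤ.+ m ℤ.* ℤ.+ suc n) ⟩
      - fromℤ (ℤ.+ m ℤ.* ℤ.+ suc n)        ≈⟨ -‿cong (fromℤ-*⁺ m (suc n)) ⟩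
      - (m ×ⁿ 1# * suc n ×ⁿ 1#)            ≈⟨ -‿distribʳ-* _ _ ⟩
      m ×ⁿ 1# * - (suc n ×ⁿ 1#)            ∎

    fromℤ-* : ∀ i j → fromℤ (i ℤ.* j) ≈ fromℤ i * fromℤ j
    fromℤ-* (ℤ.+ m)  j = fromℤ-*ʳ m j
    fromℤ-* -[1+ m ] j = begin
      fromℤ (-[1+ m ] ℤ.* j)               ≡⟨ ≡.cong fromℤ (ℤ.neg-distribˡ-* (ℤ.+ suc m) j) ⟨
      fromℤ (ℤ.- (ℤ.+ suc m ℤ.* j))        ≈⟨ fromℤ-neg (ℤ.+ suc m ℤ.* j) ⟩
      - fromℤ (ℤ.+ suc m ℤ.* j)            ≈⟨ -‿cong (fromℤ-*ʳ (suc m) j) ⟩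
      - (suc m ×ⁿ 1# * fromℤ j)            ≈⟨ -‿distribˡ-* _ _ ⟩
      - (suc m ×ⁿ 1#) * fromℤ j            ∎

    morphism : CommutativeRing.rawRing ℤ.+-*-commutativeRing
               -Raw-AlmostCommutative⟶ fromCommutativeRing R
    morphism = record
      { ⟦_⟧    = fromℤ
      ; +-homo = fromℤ-+
      ; *-homo = fromℤ-*
      ; -‿homo = fromℤ-neg
      ; 0-homo = refl
      ; 1-homo = refl
      }

    coefficient-≟ : ∀ i j → _
    coefficient-≟ i j with i ℤ.≟ j
    ... | yes i≡j = just (reflexive (≡.cong fromℤ i≡j))
    ... | no  _   = nothing

  open Algebra.Solver.Ring _ (fromCommutativeRing R) morphism coefficient-≟ public
    using (solve; Polynomial; _:=_; _:+_; _:*_; _:-_; :-_; con)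

  -- `fromℤ` takes these constants to `0#` and `1#` by computation, so solved equations match goals
  -- that mention the units of the ring.
  :0 :1 : ∀ {n} → Polynomial n
  :0 = con (ℤ.+ 0)
  :1 = con (ℤ.+ 1)

-- Consequences of the ordered field axioms.

module OrderedField (ℝ : RealNumbers) where

  open RealNumbers ℝ
  open RingProperties ring public using (-0#≈0#)
  open IntegerRingSolver commutativeRing public
  open IsStrictTotalOrder isStrictTotalOrder public
    using (compare; _≟_; irrefl)
    renaming (trans to <-trans; <-respʳ-≈ to <-respʳ; <-respˡ-≈ to <-respˡ)
  open SetoidReasoning setoid

  <⇒≤ : ∀ {x y} → x < y → x ≤ y
  <⇒≤ = inj₁

  ≤-reflexive : ∀ {x y} → x ≈ y → x ≤ y
  ≤-reflexive = inj₂

  ≤-respʳ : ∀ {x y z} → y ≈ z → x ≤ y → x ≤ z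
  ≤-respʳ y≈z (inj₁ x<y) = inj₁ (<-respʳ y≈z x<y)
  ≤-respʳ y≈z (inj₂ x≈y) = inj₂ (trans x≈y y≈z)

  <-≤-trans : ∀ {x y z} → x < y → y ≤ z → x < z
  <-≤-trans x<y (inj₁ y<z) = <-trans x<y y<z
  <-≤-trans x<y (inj₂ y≈z) = <-respʳ y≈z x<y

  <⇒≉ : ∀ {x y} → x < y → ¬ (x ≈ y)
  <⇒≉ x<y x≈y = irrefl x≈y x<y

  <⇒≱ : ∀ {x y} → x < y → ¬ (y ≤ x)
  <⇒≱ x<y y≤x = irrefl refl (<-≤-trans x<y y≤x)

  ≤-antisym : ∀ {x y} → x ≤ y → y ≤ x → x ≈ y
  ≤-antisym (inj₁ x<y) y≤x = contradiction y≤x (<⇒≱ x<y)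
  ≤-antisym (inj₂ x≈y) _   = x≈y

  ≰⇒> : ∀ {x y} → ¬ (x ≤ y) → y < x
  ≰⇒> {x} {y} x≰y with compare x y
  ... | tri< x<y _ _ = contradiction (inj₁ x<y) x≰y
  ... | tri≈ _ x≈y _ = contradiction (inj₂ x≈y) x≰y
  ... | tri> _ _ y<x = y<x

  0≤⇒≉⇒0< : ∀ {x} → 0# ≤ x → ¬ (x ≈ 0#) → 0# < x
  0≤⇒≉⇒0< (inj₁ 0<x) _   = 0<x
  0≤⇒≉⇒0< (inj₂ 0≈x) x≉0 = contradiction (sym 0≈x) x≉0

  +-pos : ∀ {x y} → 0# < x → 0# ≤ y → 0# < x + y
  +-pos {x} {y} 0<x (inj₁ 0<y) = <-trans 0<x (<-respˡ (+-identityʳ x) (+-monoʳ-< x 0<y))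
  +-pos {x} {y} 0<x (inj₂ 0≈y) = <-respʳ (trans (sym (+-identityʳ x)) (+-congˡ 0≈y)) 0<x

  +-nonneg : ∀ {x y} → 0# ≤ x → 0# ≤ y → 0# ≤ x + y
  +-nonneg (inj₁ 0<x) 0≤y = inj₁ (+-pos 0<x 0≤y)
  +-nonneg {x} {y} (inj₂ 0≈x) 0≤y =
    ≤-respʳ (trans (sym (+-identityˡ y)) (+-congʳ 0≈x)) 0≤y

  *-nonneg : ∀ {x y} → 0# ≤ x → 0# ≤ y → 0# ≤ x * y
  *-nonneg {x} {y} (inj₂ 0≈x) _ = inj₂ (sym (trans (*-congʳ (sym 0≈x)) (zeroˡ y)))
  *-nonneg {x} {y} _ (inj₂ 0≈y) = inj₂ (sym (trans (*-congˡ (sym 0≈y)) (zeroʳ x)))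
  *-nonneg (inj₁ 0<x) (inj₁ 0<y) = inj₁ (*-pos 0<x 0<y)

  ≤⇒0≤- : ∀ {x y} → x ≤ y → 0# ≤ y - x
  ≤⇒0≤- {x} {y} (inj₂ x≈y) = inj₂ (sym (trans (+-congˡ (-‿cong x≈y)) (-‿inverseʳ y)))
  ≤⇒0≤- {x} {y} (inj₁ x<y) =
    inj₁ (<-respˡ (-‿inverseˡ x) (<-respʳ (+-comm (- x) y) (+-monoʳ-< (- x) x<y)))

  0<-⇒< : ∀ {x y} → 0# < y - x → x < y
  0<-⇒< {x} {y} 0<d = <-respˡ (+-identityʳ x)
    (<-respʳ (solve 2 (λ x y → x :+ (y :- x) := y) refl x y) (+-monoʳ-< x 0<d))

  0≤-⇒≤ : ∀ {x y} → 0# ≤ y - x → x ≤ y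
  0≤-⇒≤ (inj₁ 0<d) = inj₁ (0<-⇒< 0<d)
  0≤-⇒≤ {x} {y} (inj₂ 0≈d) = inj₂ (begin
    x            ≈⟨ +-identityʳ x ⟨
    x + 0#       ≈⟨ +-congˡ 0≈d ⟩
    x + (y - x)  ≈⟨ solve 2 (λ x y → x :+ (y :- x) := y) refl x y ⟩
    y            ∎)

  <⇒0<- : ∀ {x y} → x < y → 0# < y - x
  <⇒0<- {x} {y} x<y =
    <-respˡ (-‿inverseˡ x) (<-respʳ (+-comm (- x) y) (+-monoʳ-< (- x) x<y))

  square-nonneg : ∀ x → 0# ≤ x * x
  square-nonneg x with compare 0# x
  ... | tri< 0<x _ _ = inj₁ (*-pos 0<x 0<x)
  ... | tri≈ _ 0≈x _ = *-nonneg (inj₂ 0≈x) (inj₂ 0≈x)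
  ... | tri> _ _ x<0 = inj₁ (<-respʳ
    (solve 1 (λ x → (:0 :- x) :* (:0 :- x) := x :* x) refl x)
    (*-pos (<⇒0<- x<0) (<⇒0<- x<0)))

  0<1 : 0# < 1#
  0<1 = 0≤⇒≉⇒0< (≤-respʳ (*-identityˡ 1#) (square-nonneg 1#)) (λ 1≈0 → 0≉1 (sym 1≈0))

  0<2 : 0# < 1# + 1#
  0<2 = +-pos 0<1 (<⇒≤ 0<1)

  1≉0 : ¬ (1# ≈ 0#)
  1≉0 e = 0≉1 (sym e)

  *-cancelˡ-0 : ∀ {x y} → ¬ (x ≈ 0#) → x * y ≈ 0# → y ≈ 0#
  *-cancelˡ-0 {x} {y} x≉0 xy≈0 with inverse x x≉0
  ... | x⁻¹ , xx⁻¹≈1 = begin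
    y              ≈⟨ *-identityˡ y ⟨
    1# * y         ≈⟨ *-congʳ xx⁻¹≈1 ⟨
    x * x⁻¹ * y    ≈⟨ solve 3 (λ x i y → x :* i :* y := i :* (x :* y)) refl x x⁻¹ y ⟩
    x⁻¹ * (x * y)  ≈⟨ *-congˡ xy≈0 ⟩
    x⁻¹ * 0#       ≈⟨ zeroʳ x⁻¹ ⟩
    0#             ∎

  -- If `y` were at most zero, `x` times its negative would be nonnegative, yet that product is
  -- minus one.
  positive-inverse : ∀ {x} → 0# < x → ∃ λ y → 0# < y × x * y ≈ 1#
  positive-inverse {x} 0<x with inverse x (λ x≈0 → <⇒≉ 0<x (sym x≈0))
  ... | y , xy≈1 = y , ≰⇒> ¬y≤0 , xy≈1
    where
    ¬y≤0 : ¬ (y ≤ 0#)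
    ¬y≤0 y≤0 = <⇒≱ 0<1 (0≤-⇒≤ (≤-respʳ
      (trans (solve 2 (λ x y → x :* (:0 :- y) := :0 :- x :* y) refl x y)
             (+-congˡ (-‿cong xy≈1)))
      (*-nonneg (<⇒≤ 0<x) (≤⇒0≤- y≤0))))

  square-0 : ∀ {x} → x * x ≤ 0# → x ≈ 0#
  square-0 {x} xx≤0 with x ≟ 0#
  ... | yes x≈0 = x≈0
  ... | no  x≉0 = *-cancelˡ-0 x≉0 (≤-antisym xx≤0 (square-nonneg x))

  *-cancelˡ-≥0 : ∀ {x y} → 0# < x → 0# ≤ x * y → 0# ≤ y
  *-cancelˡ-≥0 {x} {y} 0<x 0≤xy with positive-inverse 0<x
  ... | i , 0<i , xi≈1 = ≤-respʳ (begin
    i * (x * y)  ≈⟨ solve 3 (λ x i y → i :* (x :* y) := x :* i :* y) refl x i y ⟩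
    x * i * y    ≈⟨ *-congʳ xi≈1 ⟩
    1# * y       ≈⟨ *-identityˡ y ⟩
    y            ∎) (*-nonneg (<⇒≤ 0<i) 0≤xy)

  x≈y⇒x-y≈0 : ∀ {x y} → x ≈ y → x - y ≈ 0#
  x≈y⇒x-y≈0 {x} {y} x≈y = trans (+-congʳ x≈y) (-‿inverseʳ y)

  x-y≈0⇒x≈y : ∀ {x y} → x - y ≈ 0# → x ≈ y
  x-y≈0⇒x≈y {x} {y} d≈0 = begin
    x          ≈⟨ solve 2 (λ x y → x := x :- y :+ y) refl x y ⟩
    x - y + y  ≈⟨ +-congʳ d≈0 ⟩
    0# + y     ≈⟨ +-identityˡ y ⟩
    y          ∎

-- Finite sums, the Kronecker delta and transport of weights along a map.

module FiniteSums (ℝ : RealNumbers) where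

  open RealNumbers ℝ hiding (zero)
  open OrderedField ℝ
  open SemiringSum semiring public
    using (sum; sum-syntax; ∑-distrib-+; ∑-comm; *-distribˡ-sum; *-distribʳ-sum; sum-replicate-zero)
    renaming (sum-cong-≋ to sum-cong)
  open SetoidReasoning setoid

  sum-0 : ∀ {n} {f : Fin n → Carrier} → (∀ i → f i ≈ 0#) → sum f ≈ 0#
  sum-0 {n} f≈0 = trans (sum-cong f≈0) (sum-replicate-zero n)

  sum-lin : ∀ {n} α β (f g : Fin n → Carrier) →
            ∑[ i < n ] (α * f i + β * g i) ≈ α * sum f + β * sum g
  sum-lin α β f g = trans (∑-distrib-+ (λ i → α * f i) (λ i → β * g i))
    (sym (+-cong (*-distribˡ-sum α f) (*-distribˡ-sum β g)))

  sum-sub : ∀ {n} (f g : Fin n → Carrier) →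
            ∑[ i < n ] (f i - g i) ≈ sum f - sum g
  sum-sub {n} f g = begin
    ∑[ i < n ] (f i - g i)
      ≈⟨ sum-cong (λ i → solve 2 (λ x y → x :- y := :1 :* x :+ (:- :1) :* y) refl (f i) (g i)) ⟩
    ∑[ i < n ] (1# * f i + - 1# * g i)
      ≈⟨ sum-lin 1# (- 1#) f g ⟩
    1# * sum f + - 1# * sum g
      ≈⟨ solve 2 (λ x y → x :- y := :1 :* x :+ (:- :1) :* y) refl (sum f) (sum g) ⟨
    sum f - sum g ∎

  sum-nonneg : ∀ {n} {f : Fin n → Carrier} → (∀ i → 0# ≤ f i) → 0# ≤ sum f
  sum-nonneg {zero}  0≤f = ≤-reflexive refl
  sum-nonneg {suc n} 0≤f = +-nonneg (0≤f zero) (sum-nonneg (0≤f ∘ suc))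

  term≤sum : ∀ {n} {f : Fin n → Carrier} → (∀ i → 0# ≤ f i) → ∀ i → f i ≤ sum f
  term≤sum {f = f} 0≤f zero = 0≤-⇒≤ (≤-respʳ
    (solve 2 (λ x y → y := x :+ y :- x) refl (f zero) (sum (f ∘ suc)))
    (sum-nonneg (0≤f ∘ suc)))
  term≤sum {f = f} 0≤f (suc i) = 0≤-⇒≤ (≤-respʳ
    (solve 3 (λ x y z → x :+ (y :- z) := x :+ y :- z) refl (f zero) (sum (f ∘ suc)) (f (suc i)))
    (+-nonneg (0≤f zero) (≤⇒0≤- (term≤sum (0≤f ∘ suc) i))))

  sum-nonneg-0 : ∀ {n} {f : Fin n → Carrier} → (∀ i → 0# ≤ f i) →
                 sum f ≈ 0# → ∀ i → f i ≈ 0#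
  sum-nonneg-0 0≤f Σf≈0 i = ≤-antisym (≤-respʳ Σf≈0 (term≤sum 0≤f i)) (0≤f i)

  -- Trichotomy decides equality with `0#`, so the index can be found by search. This supplies
  -- witnesses where only a contradiction would otherwise be available.
  nonzero-term : ∀ {n} (f : Fin n → Carrier) → ¬ (sum f ≈ 0#) → ∃ λ i → ¬ (f i ≈ 0#)
  nonzero-term {n} f Σf≉0 with Fin.any? (λ i → ¬? (f i ≟ 0#))
  ... | yes found = found
  ... | no  none  = contradiction
    (sum-0 (λ i → decidable-stable (f i ≟ 0#) (λ fi≉0 → none (i , fi≉0)))) Σf≉0

  δ : ∀ {n} → Fin n → Fin n → Carrier
  δ zero    zero    = 1#
  δ zero    (suc j) = 0#
  δ (suc i) zero    = 0#
  δ (suc i) (suc j) = δ i j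

  δ-refl : ∀ {n} (i : Fin n) → δ i i ≈ 1#
  δ-refl zero    = refl
  δ-refl (suc i) = δ-refl i

  δ-≢ : ∀ {n} {i j : Fin n} → i ≢ j → δ i j ≈ 0#
  δ-≢ {i = zero}  {zero}  i≢j = contradiction ≡.refl i≢j
  δ-≢ {i = zero}  {suc j} i≢j = refl
  δ-≢ {i = suc i} {zero}  i≢j = refl
  δ-≢ {i = suc i} {suc j} i≢j = δ-≢ (i≢j ∘ ≡.cong suc)

  δ-sym : ∀ {n} (i j : Fin n) → δ i j ≈ δ j i
  δ-sym zero    zero    = refl
  δ-sym zero    (suc j) = refl
  δ-sym (suc i) zero    = refl
  δ-sym (suc i) (suc j) = δ-sym i j

  δ-nonneg : ∀ {n} (i j : Fin n) → 0# ≤ δ i j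
  δ-nonneg zero    zero    = <⇒≤ 0<1
  δ-nonneg zero    (suc j) = ≤-reflexive refl
  δ-nonneg (suc i) zero    = ≤-reflexive refl
  δ-nonneg (suc i) (suc j) = δ-nonneg i j

  sum-δ : ∀ {n} (i : Fin n) (f : Fin n → Carrier) → ∑[ j < n ] (δ i j * f j) ≈ f i
  sum-δ {suc n} zero f = begin
    1# * f zero + ∑[ j < n ] (0# * f (suc j))
      ≈⟨ +-cong (*-identityˡ _) (sum-0 (λ j → zeroˡ (f (suc j)))) ⟩
    f zero + 0#  ≈⟨ +-identityʳ _ ⟩
    f zero       ∎
  sum-δ (suc i) f = trans (+-cong (zeroˡ _) (sum-δ i (f ∘ suc))) (+-identityˡ _)

  sum-δʳ : ∀ {n} (i : Fin n) (f : Fin n → Carrier) → ∑[ j < n ] (f j * δ j i) ≈ f i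
  sum-δʳ {n} i f = trans
    (sum-cong (λ j → trans (*-comm (f j) (δ j i)) (*-congʳ (δ-sym j i)))) (sum-δ i f)

  sum-δ-1 : ∀ {n} (i : Fin n) → ∑[ j < n ] δ i j ≈ 1#
  sum-δ-1 i = trans (sum-cong (λ j → sym (*-identityʳ (δ i j)))) (sum-δ i (λ _ → 1#))

  -- The image of the weights under `ρ`, as for a measure: indices with the same image have their
  -- weights added. It turns a combination of points drawn from a family, possibly with repetition,
  -- into one indexed by the family itself.
  pushforward : ∀ {m k} → (Fin m → Fin k) → (Fin m → Carrier) → Fin k → Carrier
  pushforward {m} ρ c j = ∑[ i < m ] (δ (ρ i) j * c i)

  sum-pushforward : ∀ {m k} (ρ : Fin m → Fin k) (c : Fin m → Carrier) (f : Fin k → Carrier) →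
    ∑[ j < k ] (pushforward ρ c j * f j) ≈ ∑[ i < m ] (c i * f (ρ i))
  sum-pushforward {m} {k} ρ c f = begin
    ∑[ j < k ] (∑[ i < m ] (δ (ρ i) j * c i) * f j)
      ≈⟨ sum-cong (λ j → *-distribʳ-sum (f j) (λ i → δ (ρ i) j * c i)) ⟩
    ∑[ j < k ] ∑[ i < m ] (δ (ρ i) j * c i * f j)
      ≈⟨ ∑-comm (λ j i → δ (ρ i) j * c i * f j) ⟩
    ∑[ i < m ] ∑[ j < k ] (δ (ρ i) j * c i * f j)
      ≈⟨ sum-cong (λ i → sum-cong (λ j →
           solve 3 (λ d c f → d :* c :* f := c :* (d :* f)) refl (δ (ρ i) j) (c i) (f j))) ⟩
    ∑[ i < m ] ∑[ j < k ] (c i * (δ (ρ i) j * f j))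
      ≈⟨ sum-cong (λ i → *-distribˡ-sum (c i) (λ j → δ (ρ i) j * f j)) ⟨
    ∑[ i < m ] (c i * ∑[ j < k ] (δ (ρ i) j * f j))
      ≈⟨ sum-cong (λ i → *-congˡ (sum-δ (ρ i) f)) ⟩
    ∑[ i < m ] (c i * f (ρ i)) ∎

  sum-pushforward-1 : ∀ {m k} (ρ : Fin m → Fin k) (c : Fin m → Carrier) →
    sum (pushforward ρ c) ≈ sum c
  sum-pushforward-1 ρ c = begin
    sum (pushforward ρ c)  ≈⟨ sum-cong (λ j → *-identityʳ (pushforward ρ c j)) ⟨
    _                      ≈⟨ sum-pushforward ρ c (λ _ → 1#) ⟩
    _                      ≈⟨ sum-cong (λ i → *-identityʳ (c i)) ⟩
    sum c                  ∎

  pushforward-nonneg : ∀ {m k} (ρ : Fin m → Fin k) {c : Fin m → Carrier} →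
    (∀ i → 0# ≤ c i) → ∀ j → 0# ≤ pushforward ρ c j
  pushforward-nonneg ρ 0≤c j = sum-nonneg (λ i → *-nonneg (δ-nonneg (ρ i) j) (0≤c i))

  pushforward-injective : ∀ {m k} (ρ : Fin m → Fin k) (c : Fin m → Carrier) →
    (∀ {i j} → ρ i ≡ ρ j → i ≡ j) → ∀ i → pushforward ρ c (ρ i) ≈ c i
  pushforward-injective ρ c inj i = trans (sum-cong (λ j → *-congʳ (δ-inj j))) (sum-δ i c)
    where
    δ-inj : ∀ j → δ (ρ j) (ρ i) ≈ δ i j
    δ-inj j with i Fin.≟ j
    ... | yes ≡.refl = trans (δ-refl (ρ i)) (sym (δ-refl i))
    ... | no  i≢j    = trans (δ-≢ (λ e → i≢j (≡.sym (inj e)))) (sym (δ-≢ i≢j))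

  pushforward-support : ∀ {m k} (ρ : Fin m → Fin k) (c : Fin m → Carrier) j →
    ¬ (pushforward ρ c j ≈ 0#) → ∃ λ i → ρ i ≡ j
  pushforward-support ρ c j push≉0 with nonzero-term _ push≉0
  ... | i , term≉0 = i , decidable-stable (ρ i Fin.≟ j)
    (λ ρi≢j → term≉0 (trans (*-congʳ (δ-≢ ρi≢j)) (zeroˡ (c i))))

-- Linear combinations, linear dependence and dual families.

module LinearAlgebra (ℝ : RealNumbers) where

  open RealNumbers ℝ hiding (zero)
  open OrderedField ℝ
  open Geometry ℝ
  open FiniteSums ℝ
  open SetoidReasoning setoid

  combination-congˡ : ∀ {I k} {c d : Fin k → Carrier} (p : Fin k → Space I) →
    (∀ i → c i ≈ d i) → combination c p ≋ combination d p
  combination-congˡ p c≈d a = sum-cong (λ i → *-congʳ (c≈d i))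

  combination-congʳ : ∀ {I k} (c : Fin k → Carrier) {p q : Fin k → Space I} →
    (∀ i → p i ≋ q i) → combination c p ≋ combination c q
  combination-congʳ c p≋q a = sum-cong (λ i → *-congˡ (p≋q i a))

  combination-lin : ∀ {I k} α β (c d : Fin k → Carrier) (p : Fin k → Space I) a →
    combination (λ i → α * c i + β * d i) p a ≈ α * combination c p a + β * combination d p a
  combination-lin α β c d p a = trans
    (sum-cong (λ i → solve 5 (λ α β c d p →
       (α :* c :+ β :* d) :* p := α :* (c :* p) :+ β :* (d :* p)) refl α β (c i) (d i) (p i a)))
    (sum-lin α β (λ i → c i * p i a) (λ i → d i * p i a))

  combination-sub : ∀ {I k} (c d : Fin k → Carrier) (p : Fin k → Space I) a →
    combination (λ i → c i - d i) p a ≈ combination c p a - combination d p a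
  combination-sub c d p a = trans
    (sum-cong (λ i → solve 3 (λ c d p → (c :- d) :* p := c :* p :- d :* p) refl (c i) (d i) (p i a)))
    (sum-sub (λ i → c i * p i a) (λ i → d i * p i a))

  combination-pushforward : ∀ {I m k} (ρ : Fin m → Fin k) (c : Fin m → Carrier)
    (p : Fin k → Space I) → combination (pushforward ρ c) p ≋ combination c (p ∘ ρ)
  combination-pushforward ρ c p a = sum-pushforward ρ c (λ j → p j a)

  combination-δ : ∀ {I k} (i : Fin k) (p : Fin k → Space I) → combination (δ i) p ≋ p i
  combination-δ i p a = sum-δ i (λ j → p j a)

  combination-∘ : ∀ {I k l} (c : Fin k → Carrier) (C : Fin k → Fin l → Carrier)
    (p : Fin l → Space I) →
    combination (combination c C) p ≋ combination c (λ i → combination (C i) p)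
  combination-∘ {k = k} {l} c C p a = begin
    ∑[ j < l ] (∑[ i < k ] (c i * C i j) * p j a)
      ≈⟨ sum-cong (λ j → *-distribʳ-sum (p j a) (λ i → c i * C i j)) ⟩
    ∑[ j < l ] ∑[ i < k ] (c i * C i j * p j a)
      ≈⟨ ∑-comm (λ j i → c i * C i j * p j a) ⟩
    ∑[ i < k ] ∑[ j < l ] (c i * C i j * p j a)
      ≈⟨ sum-cong (λ i → sum-cong (λ j → *-assoc (c i) (C i j) (p j a))) ⟩
    ∑[ i < k ] ∑[ j < l ] (c i * (C i j * p j a))
      ≈⟨ sum-cong (λ i → *-distribˡ-sum (c i) (λ j → C i j * p j a)) ⟨
    ∑[ i < k ] (c i * ∑[ j < l ] (C i j * p j a)) ∎

  infixr 5 _◂_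
  _◂_ : ∀ {A : Set} {k} → A → (Fin k → A) → Fin (suc k) → A
  (x ◂ f) zero    = x
  (x ◂ f) (suc i) = f i

  -- Gaussian elimination along the first row.
  dependent : ∀ m (A : Fin (suc m) → Space (Fin m)) →
    ∃ λ c → combination c A ≋ 𝟘 × ∃ λ i → ¬ (c i ≈ 0#)
  dependent zero    A = (λ _ → 1#) , (λ ()) , zero , 1≉0
  dependent (suc m) A with Fin.any? (λ a → ¬? (A zero a ≟ 0#))
  ... | no  none = δ zero , (λ a → trans (combination-δ zero A a)
      (decidable-stable (A zero a ≟ 0#) (λ Aa≉0 → none (a , Aa≉0)))) , zero , 1≉0
  ... | yes (a , Aa≉0) with inverse (A zero a) Aa≉0
  ... | v , Aa·v≈1 with dependent m (λ j b → A (suc j) (punchIn a b) - A (suc j) a * v * A zero (punchIn a b))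
  ... | c , cA′≈0 , i , ci≉0 = - S ◂ c , vanishes , suc i , ci≉0
    where
    S = ∑[ j < suc m ] (c j * (A (suc j) a * v))

    expand : ∀ b → combination (- S ◂ c) A b ≈
             ∑[ j < suc m ] (c j * (A (suc j) b - A (suc j) a * v * A zero b))
    expand b = begin
      - S * A zero b + ∑[ j < suc m ] (c j * A (suc j) b)
        ≈⟨ solve 3 (λ s x t → (:- s) :* x :+ t := t :- s :* x) refl S (A zero b) _ ⟩
      ∑[ j < suc m ] (c j * A (suc j) b) - S * A zero b
        ≈⟨ +-congˡ (-‿cong (*-distribʳ-sum (A zero b) (λ j → c j * (A (suc j) a * v)))) ⟩
      ∑[ j < suc m ] (c j * A (suc j) b) - ∑[ j < suc m ] (c j * (A (suc j) a * v) * A zero b)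
        ≈⟨ sum-sub (λ j → c j * A (suc j) b) (λ j → c j * (A (suc j) a * v) * A zero b) ⟨
      ∑[ j < suc m ] (c j * A (suc j) b - c j * (A (suc j) a * v) * A zero b)
        ≈⟨ sum-cong (λ j → solve 4 (λ c x y z → c :* x :- c :* y :* z := c :* (x :- y :* z)) refl
             (c j) (A (suc j) b) (A (suc j) a * v) (A zero b)) ⟩
      ∑[ j < suc m ] (c j * (A (suc j) b - A (suc j) a * v * A zero b)) ∎

    pivot : ∀ j → c j * (A (suc j) a - A (suc j) a * v * A zero a) ≈ 0#
    pivot j = begin
      c j * (A (suc j) a - A (suc j) a * v * A zero a)
        ≈⟨ solve 4 (λ c x v y → c :* (x :- x :* v :* y) := c :* x :* (:1 :- y :* v)) refl
             (c j) (A (suc j) a) v (A zero a) ⟩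
      c j * A (suc j) a * (1# - A zero a * v)
        ≈⟨ *-congˡ (x≈y⇒x-y≈0 (sym Aa·v≈1)) ⟩
      c j * A (suc j) a * 0# ≈⟨ zeroʳ _ ⟩
      0# ∎

    vanishes : combination (- S ◂ c) A ≋ 𝟘
    vanishes b with a Fin.≟ b
    ... | yes ≡.refl = trans (expand a) (sum-0 pivot)
    ... | no  a≢b = ≡.subst (λ b → combination (- S ◂ c) A b ≈ 0#) (Fin.punchIn-punchOut a≢b)
      (trans (expand (punchIn a (punchOut a≢b))) (cA′≈0 (punchOut a≢b)))

  -- The d coordinate vectors of b together with the coefficients c of a relation
  -- among the generators are d + 1 vectors in a space of dimension d.
  generators-independent : ∀ {I d} (b g : Fin d → Space I) → LinearlyIndependent b →
    (∀ i → ∃ λ c → b i ≋ combination c g) → LinearlyIndependent g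
  generators-independent {d = d} b g b-independent b∈span c cg≈0 i
    with dependent d (c ◂ proj₁ ∘ b∈span)
  ... | γ , relation , k , γk≉0 = *-cancelˡ-0 γ₀≉0 (begin
      γ zero * c i
        ≈⟨ +-identityʳ _ ⟨
      γ zero * c i + 0#
        ≈⟨ +-congˡ (sum-0 (λ j → trans (*-congʳ (γ₊≈0 j)) (zeroˡ _))) ⟨
      γ zero * c i + ∑[ j < d ] (γ (suc j) * proj₁ (b∈span j) i)
        ≈⟨ relation i ⟩
      0# ∎)
    where
    γ₊ : Fin d → Carrier
    γ₊ j = γ (suc j)

    γb≈0 : combination γ₊ b ≋ 𝟘
    γb≈0 a = begin
      combination γ₊ b a
        ≈⟨ combination-congʳ γ₊ (proj₂ ∘ b∈span) a ⟩
      combination γ₊ (λ j → combination (proj₁ (b∈span j)) g) a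
        ≈⟨ +-identityˡ _ ⟨
      0# + combination γ₊ (λ j → combination (proj₁ (b∈span j)) g) a
        ≈⟨ +-congʳ (trans (*-congˡ (cg≈0 a)) (zeroʳ _)) ⟨
      combination γ (λ j → combination ((c ◂ proj₁ ∘ b∈span) j) g) a
        ≈⟨ combination-∘ γ (c ◂ proj₁ ∘ b∈span) g a ⟨
      combination (combination γ (c ◂ proj₁ ∘ b∈span)) g a
        ≈⟨ sum-0 (λ j → trans (*-congʳ (relation j)) (zeroˡ _)) ⟩
      0# ∎

    γ₊≈0 : ∀ j → γ₊ j ≈ 0#
    γ₊≈0 = b-independent γ₊ γb≈0

    nonzero : ∀ k → ¬ (γ k ≈ 0#) → ¬ (γ zero ≈ 0#)
    nonzero zero    γk≉0 = γk≉0
    nonzero (suc j) γk≉0 = contradiction (γ₊≈0 j) γk≉0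

    γ₀≉0 : ¬ (γ zero ≈ 0#)
    γ₀≉0 = nonzero k γk≉0

  infix 7 _·_
  _·_ : ∀ {n} → Space (Fin n) → Space (Fin n) → Carrier
  _·_ {n} x y = ∑[ a < n ] (x a * y a)

  ·-comm : ∀ {n} (x y : Space (Fin n)) → x · y ≈ y · x
  ·-comm x y = sum-cong (λ a → *-comm (x a) (y a))

  ·-congʳ : ∀ {n} {x y : Space (Fin n)} z → x ≋ y → x · z ≈ y · z
  ·-congʳ z x≋y = sum-cong (λ a → *-congʳ (x≋y a))

  ·-lin : ∀ {n} (x : Space (Fin n)) α β y z →
    x · (λ a → α * y a + β * z a) ≈ α * (x · y) + β * (x · z)
  ·-lin x α β y z = trans
    (sum-cong (λ a → solve 5 (λ x α β y z →
      x :* (α :* y :+ β :* z) := α :* (x :* y) :+ β :* (x :* z)) refl (x a) α β (y a) (z a)))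
    (sum-lin α β (λ a → x a * y a) (λ a → x a * z a))

  ·-combination : ∀ {n k} (x : Space (Fin n)) (c : Fin k → Carrier) p →
    x · combination c p ≈ ∑[ i < k ] (c i * (x · p i))
  ·-combination {n} {k} x c p = begin
    ∑[ a < n ] (x a * ∑[ i < k ] (c i * p i a))
      ≈⟨ sum-cong (λ a → *-distribˡ-sum (x a) (λ i → c i * p i a)) ⟩
    ∑[ a < n ] ∑[ i < k ] (x a * (c i * p i a))
      ≈⟨ ∑-comm (λ a i → x a * (c i * p i a)) ⟩
    ∑[ i < k ] ∑[ a < n ] (x a * (c i * p i a))
      ≈⟨ sum-cong (λ i → sum-cong (λ a →
           solve 3 (λ x c p → x :* (c :* p) := c :* (x :* p)) refl (x a) (c i) (p i a))) ⟩
    ∑[ i < k ] ∑[ a < n ] (c i * (x a * p i a))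
      ≈⟨ sum-cong (λ i → *-distribˡ-sum (c i) (λ a → x a * p i a)) ⟨
    ∑[ i < k ] (c i * (x · p i)) ∎

  Dual : ∀ {n k} → (p w : Fin k → Space (Fin n)) → Set
  Dual p w = ∀ i j → p i · w j ≈ δ i j

  -- Induction on the number of vectors. Removing from `p zero` its components along the later
  -- vectors, as measured by their dual family, leaves a residual that is nonzero by independence; a
  -- single nonzero coordinate `a` of it suffices to build the new dual vector.
  dual-family : ∀ {n k} (p : Fin k → Space (Fin n)) → LinearlyIndependent p → ∃ (Dual p)
  dual-family {n} {zero}  p _ = (λ ()) , (λ ())
  dual-family {n} {suc k} p p-independent
    with dual-family (p ∘ suc) (λ c cp≈0 i → p-independent (0# ◂ c)
           (λ a → trans (+-congʳ (zeroˡ _)) (trans (+-identityˡ _) (cp≈0 a))) (suc i))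
  ... | w , dual with Fin.any? (λ a → ¬? (combination (1# ◂ λ i → - (p zero · w i)) p a ≟ 0#))
  ... | no none = contradiction
      (p-independent (1# ◂ λ i → - (p zero · w i)) (λ a → decidable-stable (_ ≟ 0#) (λ qa≉0 → none (a , qa≉0))) zero)
      1≉0
  ... | yes (a , qa≉0) with inverse _ qa≉0
  ... | v , qa·v≈1 = u ◂ w′ , dual′
    where
    p₀ = p zero

    -- Pairing `x` with `u` gives `v` times the coordinate at `a` of the residual of `x`. That
    -- residual is zero for the later vectors, and for `p zero` its coordinate is the inverse of
    -- `v`.
    u : Space (Fin n)
    u b = v * δ a b + - v * combination (λ i → p (suc i) a) w b

    -- Subtracting a multiple of `u` makes `w i` orthogonal to `p zero` and leaves its pairings with
    -- the later vectors unchanged.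
    w′ : Fin k → Space (Fin n)
    w′ i b = 1# * w i b + - (p₀ · w i) * u b

    ·-u : ∀ x → x · u ≈ v * x a + - v * ∑[ i < k ] (p (suc i) a * (x · w i))
    ·-u x = trans (·-lin x v (- v) (δ a) (combination (λ i → p (suc i) a) w))
      (+-cong (*-congˡ (trans (·-comm x (δ a)) (sum-δ a x)))
              (*-congˡ (·-combination x (λ i → p (suc i) a) w)))

    p₀·u : p₀ · u ≈ 1#
    p₀·u = begin
      p₀ · u
        ≈⟨ ·-u p₀ ⟩
      v * p₀ a + - v * ∑[ i < k ] (p (suc i) a * (p₀ · w i))
        ≈⟨ +-congˡ (*-congˡ (sum-cong (λ i → *-comm (p (suc i) a) (p₀ · w i)))) ⟩
      v * p₀ a + - v * ∑[ i < k ] ((p₀ · w i) * p (suc i) a)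
        ≈⟨ solve 3 (λ v x s → v :* x :+ (:- v) :* s := (:1 :* x :+ (:0 :- s)) :* v) refl v (p₀ a) _ ⟩
      (1# * p₀ a + (0# - ∑[ i < k ] ((p₀ · w i) * p (suc i) a))) * v
        ≈⟨ *-congʳ (+-congˡ (+-congʳ (sum-0 {n = k} (λ _ → refl)))) ⟨
      (1# * p₀ a + (∑[ i < k ] 0# - ∑[ i < k ] ((p₀ · w i) * p (suc i) a))) * v
        ≈⟨ *-congʳ (+-congˡ (sum-sub (λ _ → 0#) (λ i → (p₀ · w i) * p (suc i) a))) ⟨
      (1# * p₀ a + ∑[ i < k ] (0# - (p₀ · w i) * p (suc i) a)) * v
        ≈⟨ *-congʳ (+-congˡ (sum-cong (λ i →
             solve 2 (λ x y → :0 :- x :* y := (:- x) :* y) refl (p₀ · w i) (p (suc i) a)))) ⟩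
      (1# * p₀ a + ∑[ i < k ] (- (p₀ · w i) * p (suc i) a)) * v
        ≈⟨ qa·v≈1 ⟩
      1# ∎

    p₊·u : ∀ j → p (suc j) · u ≈ 0#
    p₊·u j = begin
      p (suc j) · u
        ≈⟨ ·-u (p (suc j)) ⟩
      v * p (suc j) a + - v * ∑[ i < k ] (p (suc i) a * (p (suc j) · w i))
        ≈⟨ +-congˡ (*-congˡ (sum-cong (λ i → *-congˡ (trans (dual j i) (δ-sym j i))))) ⟩
      v * p (suc j) a + - v * ∑[ i < k ] (p (suc i) a * δ i j)
        ≈⟨ +-congˡ (*-congˡ (sum-δʳ j (λ i → p (suc i) a))) ⟩
      v * p (suc j) a + - v * p (suc j) a
        ≈⟨ solve 2 (λ v x → v :* x :+ (:- v) :* x := :0) refl v (p (suc j) a) ⟩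
      0# ∎

    dual′ : Dual p (u ◂ w′)
    dual′ zero    zero    = p₀·u
    dual′ (suc i) zero    = p₊·u i
    dual′ zero    (suc j) = begin
      p₀ · w′ j
        ≈⟨ ·-lin p₀ 1# (- (p₀ · w j)) (w j) u ⟩
      1# * (p₀ · w j) + - (p₀ · w j) * (p₀ · u)
        ≈⟨ +-congˡ (*-congˡ p₀·u) ⟩
      1# * (p₀ · w j) + - (p₀ · w j) * 1#
        ≈⟨ solve 1 (λ x → :1 :* x :+ (:- x) :* :1 := :0) refl (p₀ · w j) ⟩
      0# ∎
    dual′ (suc i) (suc j) = begin
      p (suc i) · w′ j
        ≈⟨ ·-lin (p (suc i)) 1# (- (p₀ · w j)) (w j) u ⟩
      1# * (p (suc i) · w j) + - (p₀ · w j) * (p (suc i) · u)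
        ≈⟨ +-cong (*-identityˡ _) (*-congˡ (p₊·u i)) ⟩
      p (suc i) · w j + - (p₀ · w j) * 0#
        ≈⟨ trans (+-cong (dual i j) (zeroʳ _)) (+-identityʳ _) ⟩
      δ i j ∎

-- Bilinear forms of matrices, extreme points of the elliptope, convex hulls.

module Elliptopes (ℝ : RealNumbers) where

  open RealNumbers ℝ hiding (zero)
  open OrderedField ℝ
  open Geometry ℝ
  open FiniteSums ℝ
  open LinearAlgebra ℝ
  open SetoidReasoning setoid

  bilinear : ∀ {n} → Matrix n → Space (Fin n) → Space (Fin n) → Carrier
  bilinear {n} X u v = ∑[ a < n ] ∑[ b < n ] (u a * X (a , b) * v b)

  bilinear-cong : ∀ {n} {X Y : Matrix n} → X ≋ Y → ∀ u v → bilinear X u v ≈ bilinear Y u v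
  bilinear-cong X≋Y u v =
    sum-cong (λ a → sum-cong (λ b → *-congʳ (*-congˡ (X≋Y (a , b)))))

  bilinear-mix : ∀ {n} α β (X Y : Matrix n) u v →
    bilinear (λ e → α * X e + β * Y e) u v ≈ α * bilinear X u v + β * bilinear Y u v
  bilinear-mix {n} α β X Y u v = trans
    (sum-cong (λ a → trans
      (sum-cong (λ b → solve 6 (λ α β x y u v →
         u :* (α :* x :+ β :* y) :* v := α :* (u :* x :* v) :+ β :* (u :* y :* v)) refl
         α β (X (a , b)) (Y (a , b)) (u a) (v b)))
      (sum-lin α β (λ b → u a * X (a , b) * v b) (λ b → u a * Y (a , b) * v b))))
    (sum-lin α β (λ a → ∑[ b < n ] (u a * X (a , b) * v b)) (λ a → ∑[ b < n ] (u a * Y (a , b) * v b)))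

  bilinear-combination : ∀ {n k} (c : Fin k → Carrier) (P : Fin k → Matrix n) u v →
    bilinear (combination c P) u v ≈ ∑[ i < k ] (c i * bilinear (P i) u v)
  bilinear-combination {k = zero} c P u v =
    sum-0 (λ a → sum-0 (λ b → trans (*-congʳ (zeroʳ (u a))) (zeroˡ (v b))))
  bilinear-combination {k = suc k} c P u v = begin
    bilinear (combination c P) u v
      ≈⟨ bilinear-cong (λ e → +-congˡ (sym (*-identityˡ _))) u v ⟩
    bilinear (λ e → c zero * P zero e + 1# * combination (c ∘ suc) (P ∘ suc) e) u v
      ≈⟨ bilinear-mix (c zero) 1# (P zero) (combination (c ∘ suc) (P ∘ suc)) u v ⟩
    c zero * bilinear (P zero) u v + 1# * bilinear (combination (c ∘ suc) (P ∘ suc)) u v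
      ≈⟨ +-congˡ (trans (*-identityˡ _) (bilinear-combination (c ∘ suc) (P ∘ suc) u v)) ⟩
    ∑[ i < suc k ] (c i * bilinear (P i) u v) ∎

  bilinear-rank-one : ∀ {n} (x y u v : Space (Fin n)) →
    bilinear (λ (a , b) → x a * y b) u v ≈ (u · x) * (y · v)
  bilinear-rank-one {n} x y u v = begin
    ∑[ a < n ] ∑[ b < n ] (u a * (x a * y b) * v b)
      ≈⟨ sum-cong (λ a → sum-cong (λ b → solve 4 (λ u x y v →
           u :* (x :* y) :* v := u :* x :* (y :* v)) refl (u a) (x a) (y b) (v b))) ⟩
    ∑[ a < n ] ∑[ b < n ] (u a * x a * (y b * v b))
      ≈⟨ sum-cong (λ a → *-distribˡ-sum (u a * x a) (λ b → y b * v b)) ⟨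
    ∑[ a < n ] (u a * x a * (y · v))
      ≈⟨ *-distribʳ-sum (y · v) (λ a → u a * x a) ⟨
    (u · x) * (y · v) ∎

  -- Contracting the left argument first gives a dot product with the row `uᵗX`, so linearity in the
  -- right argument is inherited from the dot product.
  bilinear-· : ∀ {n} (X : Matrix n) u v →
    bilinear X u v ≈ (λ b → ∑[ a < n ] (u a * X (a , b))) · v
  bilinear-· X u v = trans (∑-comm (λ a b → u a * X (a , b) * v b))
    (sum-cong (λ b → sym (*-distribʳ-sum (v b) (λ a → u a * X (a , b)))))

  bilinear-linʳ : ∀ {n} (X : Matrix n) u α β v w →
    bilinear X u (λ a → α * v a + β * w a) ≈ α * bilinear X u v + β * bilinear X u w
  bilinear-linʳ X u α β v w = trans (bilinear-· X u _) (trans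
    (·-lin (λ b → ∑[ a < _ ] (u a * X (a , b))) α β v w)
    (sym (+-cong (*-congˡ (bilinear-· X u v)) (*-congˡ (bilinear-· X u w)))))

  bilinear-combinationʳ : ∀ {n k} (X : Matrix n) u (c : Fin k → Carrier) w →
    bilinear X u (combination c w) ≈ ∑[ i < k ] (c i * bilinear X u (w i))
  bilinear-combinationʳ X u c w = trans (bilinear-· X u _) (trans
    (·-combination (λ b → ∑[ a < _ ] (u a * X (a , b))) c w)
    (sum-cong (λ i → *-congˡ (sym (bilinear-· X u (w i))))))

  bilinear-sym : ∀ {n} {X : Matrix n} → Symmetric X → ∀ u v → bilinear X u v ≈ bilinear X v u
  bilinear-sym {X = X} symmetric u v = trans (∑-comm (λ a b → u a * X (a , b) * v b))
    (sum-cong (λ b → sum-cong (λ a → trans (*-congʳ (*-congˡ (symmetric a b)))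
      (solve 3 (λ u x v → u :* x :* v := v :* x :* u) refl (u a) (X (b , a)) (v b)))))

  bilinear-square : ∀ {n} {X : Matrix n} → Symmetric X → ∀ α β u v →
    bilinear X (λ a → α * u a + β * v a) (λ a → α * u a + β * v a) ≈
    α * α * bilinear X u u + (1# + 1#) * (α * β * bilinear X u v) + β * β * bilinear X v v
  bilinear-square {X = X} symmetric α β u v = begin
    bilinear X z z
      ≈⟨ bilinear-linʳ X z α β u v ⟩
    α * bilinear X z u + β * bilinear X z v
      ≈⟨ +-cong (*-congˡ (bilinear-sym symmetric z u)) (*-congˡ (bilinear-sym symmetric z v)) ⟩
    α * bilinear X u z + β * bilinear X v z
      ≈⟨ +-cong (*-congˡ (bilinear-linʳ X u α β u v)) (*-congˡ (bilinear-linʳ X v α β u v)) ⟩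
    α * (α * bilinear X u u + β * bilinear X u v) + β * (α * bilinear X v u + β * bilinear X v v)
      ≈⟨ +-congˡ (*-congˡ (+-congʳ (*-congˡ (bilinear-sym symmetric v u)))) ⟩
    α * (α * bilinear X u u + β * bilinear X u v) + β * (α * bilinear X u v + β * bilinear X v v)
      ≈⟨ solve 5 (λ α β x y z → α :* (α :* x :+ β :* y) :+ β :* (α :* y :+ β :* z) :=
           α :* α :* x :+ (:1 :+ :1) :* (α :* β :* y) :+ β :* β :* z) refl α β _ _ _ ⟩
    α * α * bilinear X u u + (1# + 1#) * (α * β * bilinear X u v) + β * β * bilinear X v v ∎
    where
    z : Space (Fin _)
    z a = α * u a + β * v a

  bilinear-δ : ∀ {n} (X : Matrix n) a b → bilinear X (δ a) (δ b) ≈ X (a , b)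
  bilinear-δ {n} X a b = begin
    bilinear X (δ a) (δ b)
      ≈⟨ bilinear-· X (δ a) (δ b) ⟩
    (λ b → ∑[ a′ < n ] (δ a a′ * X (a′ , b))) · δ b
      ≈⟨ ·-congʳ (δ b) (λ b → sum-δ a (λ a′ → X (a′ , b))) ⟩
    (λ b → X (a , b)) · δ b
      ≈⟨ ·-comm (λ b → X (a , b)) (δ b) ⟩
    δ b · (λ b → X (a , b))
      ≈⟨ sum-δ b (λ b → X (a , b)) ⟩
    X (a , b) ∎

  -- With b = uᵀXv and q = uᵀXu, the form at (q + 1)v − bu is −b²(q + 2).
  psd-kernel : ∀ {n} {X : Matrix n} → Symmetric X → PositiveSemidefinite X →
    ∀ u v → bilinear X v v ≈ 0# → bilinear X u v ≈ 0#
  psd-kernel {X = X} symmetric psd u v vXv≈0 =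
    square-0 (0≤-⇒≤ (*-cancelˡ-≥0 0<q+2 (≤-respʳ form (psd z))))
    where
    b = bilinear X u v
    q = bilinear X u u

    z : Space (Fin _)
    z a = (q + 1#) * v a + - b * u a

    0<q+2 : 0# < 1# + (q + 1#)
    0<q+2 = +-pos 0<1 (+-nonneg (psd u) (<⇒≤ 0<1))

    form : bilinear X z z ≈ (1# + (q + 1#)) * (0# - b * b)
    form = begin
      bilinear X z z
        ≈⟨ bilinear-square symmetric (q + 1#) (- b) v u ⟩
      (q + 1#) * (q + 1#) * bilinear X v v + (1# + 1#) * ((q + 1#) * - b * bilinear X v u) + - b * - b * q
        ≈⟨ +-congʳ (+-cong (*-congˡ vXv≈0) (*-congˡ (*-congˡ (bilinear-sym symmetric v u)))) ⟩
      (q + 1#) * (q + 1#) * 0# + (1# + 1#) * ((q + 1#) * - b * b) + - b * - b * q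
        ≈⟨ solve 2 (λ q b → (q :+ :1) :* (q :+ :1) :* :0 :+ (:1 :+ :1) :* ((q :+ :1) :* (:- b) :* b)
             :+ (:- b) :* (:- b) :* q := (:1 :+ (q :+ :1)) :* (:0 :- b :* b)) refl q b ⟩
      (1# + (q + 1#)) * (0# - b * b) ∎

  -- Each coefficient is absorbed separately: `g` times a product of two coordinates is at least
  -- minus `g² + 1` times the squared norm. Summing over the entries gives the constant, and the
  -- extra 1 keeps it positive even for an empty sum. Every small κ of the proof is obtained from
  -- this bound.
  form-bounded-below : ∀ {r} (G : Fin r → Fin r → Carrier) → ∃ λ K → 0# < K × (∀ y →
    0# ≤ K * (y · y) + ∑[ i < r ] ∑[ j < r ] (G i j * (y i * y j)))
  form-bounded-below {r} G = 1# + K , +-pos 0<1 (sum-nonneg (λ i → sum-nonneg (λ j → 0≤k i j))) ,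
    λ y → ≤-respʳ (regroup y) (+-nonneg (0≤y·y y) (sum-nonneg (λ i → sum-nonneg (λ j → 0≤term y i j))))
    where
    k : Fin r → Fin r → Carrier
    k i j = G i j * G i j + 1#

    K = ∑[ i < r ] ∑[ j < r ] k i j

    0≤k : ∀ i j → 0# ≤ k i j
    0≤k i j = +-nonneg (square-nonneg (G i j)) (<⇒≤ 0<1)

    0≤y·y : ∀ (y : Space (Fin r)) → 0# ≤ y · y
    0≤y·y y = sum-nonneg (λ i → square-nonneg (y i))

    0≤gap : ∀ (y : Space (Fin r)) i → 0# ≤ y · y - y i * y i
    0≤gap y i = ≤⇒0≤- (term≤sum (λ i → square-nonneg (y i)) i)

    term : Space (Fin r) → Fin r → Fin r → Carrier
    term y i j = k i j * (y · y) + G i j * (y i * y j)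

    0≤term : ∀ y i j → 0# ≤ term y i j
    -- Twice the term is a sum of squares together with nonnegative multiples of the gaps between
    -- the squared norm and one squared coordinate.
    0≤term y i j = *-cancelˡ-≥0 0<2 (≤-respʳ
      (solve 4 (λ g x z Y →
         (:1 :+ :1) :* (g :* g :* (Y :- x :* x) :+ (Y :- z :* z))
           :+ ((g :* x :+ z) :* (g :* x :+ z) :+ (g :* x :* (g :* x) :+ z :* z))
         := (:1 :+ :1) :* ((g :* g :+ :1) :* Y :+ g :* (x :* z))) refl (G i j) (y i) (y j) (y · y))
      (+-nonneg
        (*-nonneg (<⇒≤ 0<2)
          (+-nonneg (*-nonneg (square-nonneg (G i j)) (0≤gap y i)) (0≤gap y j)))
        (+-nonneg (square-nonneg (G i j * y i + y j))
          (+-nonneg (square-nonneg (G i j * y i)) (square-nonneg (y j))))))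

    regroup : ∀ y → y · y + ∑[ i < r ] ∑[ j < r ] term y i j ≈
              (1# + K) * (y · y) + ∑[ i < r ] ∑[ j < r ] (G i j * (y i * y j))
    regroup y = begin
      y · y + ∑[ i < r ] ∑[ j < r ] term y i j
        ≈⟨ +-congˡ (sum-cong (λ i → ∑-distrib-+ (λ j → k i j * (y · y)) (λ j → G i j * (y i * y j)))) ⟩
      y · y + ∑[ i < r ] (∑[ j < r ] (k i j * (y · y)) + ∑[ j < r ] (G i j * (y i * y j)))
        ≈⟨ +-congˡ (∑-distrib-+ (λ i → ∑[ j < r ] (k i j * (y · y))) (λ i → ∑[ j < r ] (G i j * (y i * y j)))) ⟩
      y · y + (∑[ i < r ] ∑[ j < r ] (k i j * (y · y)) + ∑[ i < r ] ∑[ j < r ] (G i j * (y i * y j)))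
        ≈⟨ +-congˡ (+-congʳ (trans (*-distribʳ-sum (y · y) (λ i → ∑[ j < r ] k i j))
             (sum-cong (λ i → *-distribʳ-sum (y · y) (k i))))) ⟨
      y · y + (K * (y · y) + ∑[ i < r ] ∑[ j < r ] (G i j * (y i * y j)))
        ≈⟨ solve 3 (λ Y K s → Y :+ (K :* Y :+ s) := (:1 :+ K) :* Y :+ s) refl (y · y) K _ ⟩
      (1# + K) * (y · y) + ∑[ i < r ] ∑[ j < r ] (G i j * (y i * y j)) ∎

  ⟦⟧ˢ-square : ∀ x → ⟦ x ⟧ˢ * ⟦ x ⟧ˢ ≈ 1#
  ⟦⟧ˢ-square Sign.+ = *-identityˡ 1#
  ⟦⟧ˢ-square Sign.- = solve 0 ((:- :1) :* (:- :1) := :1) refl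

  outer-square : ∀ {n} (t : SignVector n) e → outer t e * outer t e ≈ 1#
  outer-square t (a , b) = begin
    ⟦ t ⟧ a * ⟦ t ⟧ b * (⟦ t ⟧ a * ⟦ t ⟧ b)
      ≈⟨ solve 2 (λ x y → x :* y :* (x :* y) := x :* x :* (y :* y)) refl (⟦ t ⟧ a) (⟦ t ⟧ b) ⟩
    ⟦ t ⟧ a * ⟦ t ⟧ a * (⟦ t ⟧ b * ⟦ t ⟧ b)
      ≈⟨ *-cong (⟦⟧ˢ-square (lookup t a)) (⟦⟧ˢ-square (lookup t b)) ⟩
    1# * 1#  ≈⟨ *-identityˡ 1# ⟩
    1#       ∎

  outer∈elliptope : ∀ {n} (t : SignVector n) → outer t ∈ Elliptope n
  outer∈elliptope t =
    (λ a b → *-comm (⟦ t ⟧ a) (⟦ t ⟧ b)) ,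
    (λ a → ⟦⟧ˢ-square (lookup t a)) ,
    (λ v → ≤-respʳ (sym (trans (bilinear-rank-one ⟦ t ⟧ ⟦ t ⟧ v v) (*-congˡ (·-comm ⟦ t ⟧ v))))
             (square-nonneg (v · ⟦ t ⟧)))

  elliptope-resp : ∀ {n} {X Y : Matrix n} → X ≋ Y → X ∈ Elliptope n → Y ∈ Elliptope n
  elliptope-resp X≋Y (symmetric , unit , psd) =
    (λ a b → trans (sym (X≋Y (a , b))) (trans (symmetric a b) (X≋Y (b , a)))) ,
    (λ a → trans (sym (X≋Y (a , a))) (unit a)) ,
    (λ v → ≤-respʳ (bilinear-cong X≋Y v v) (psd v))

  elliptope-combination : ∀ {n k} {c : Fin k → Carrier} {P : Fin k → Matrix n} →
    (∀ i → 0# ≤ c i) → sum c ≈ 1# → (∀ i → P i ∈ Elliptope n) → combination c P ∈ Elliptope n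
  elliptope-combination {c = c} {P} 0≤c Σc≈1 P∈E =
    (λ a b → sum-cong (λ i → *-congˡ (proj₁ (P∈E i) a b))) ,
    (λ a → trans (sum-cong (λ i → trans (*-congˡ (proj₁ (proj₂ (P∈E i)) a)) (*-identityʳ (c i)))) Σc≈1) ,
    (λ v → ≤-respʳ (sym (bilinear-combination c P v v))
      (sum-nonneg (λ i → *-nonneg (0≤c i) (proj₂ (proj₂ (P∈E i)) v))))

  -- With `x` and `y` the signs of `t` at `a` and `b`, the form at `x` times the basis vector of `a`
  -- minus `y` times that of `b` is twice the difference between 1 and the left side. The
  -- computation covers `a = b` as well.
  entry-bound : ∀ {n} {X : Matrix n} → X ∈ Elliptope n → ∀ (t : SignVector n) e → outer t e * X e ≤ 1#
  entry-bound {X = X} (symmetric , unit , psd) t (a , b) =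
    0≤-⇒≤ (*-cancelˡ-≥0 0<2 (≤-respʳ form (psd z)))
    where
    x = ⟦ t ⟧ a
    y = ⟦ t ⟧ b

    z : Space (Fin _)
    z c = x * δ a c + - y * δ b c

    form : bilinear X z z ≈ (1# + 1#) * (1# - x * y * X (a , b))
    form = begin
      bilinear X z z
        ≈⟨ bilinear-square symmetric x (- y) (δ a) (δ b) ⟩
      x * x * bilinear X (δ a) (δ a) + (1# + 1#) * (x * - y * bilinear X (δ a) (δ b))
        + - y * - y * bilinear X (δ b) (δ b)
        ≈⟨ +-cong (+-cong (*-cong (⟦⟧ˢ-square (lookup t a)) (trans (bilinear-δ X a a) (unit a)))
             (*-congˡ (*-congˡ (bilinear-δ X a b))))
             (*-cong (trans (solve 1 (λ y → (:- y) :* (:- y) := y :* y) refl y) (⟦⟧ˢ-square (lookup t b)))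
               (trans (bilinear-δ X b b) (unit b))) ⟩
      1# * 1# + (1# + 1#) * (x * - y * X (a , b)) + 1# * 1#
        ≈⟨ solve 3 (λ x y e → :1 :* :1 :+ (:1 :+ :1) :* (x :* (:- y) :* e) :+ :1 :* :1 :=
             (:1 :+ :1) :* (:1 :- x :* y :* e)) refl x y (X (a , b)) ⟩
      (1# + 1#) * (1# - x * y * X (a , b)) ∎

  -- Multiplying the equation at an entry by the sign `outer t e` exhibits 1 as a weighted mean of
  -- numbers that are at most 1 by `entry-bound`. Those with nonzero weight must therefore equal 1,
  -- and multiplying by the sign again recovers the entry of `P i`.
  outer-extreme : ∀ {n k} (t : SignVector n) {c : Fin k → Carrier} {P : Fin k → Matrix n} →
    (∀ i → 0# ≤ c i) → sum c ≈ 1# → (∀ i → P i ∈ Elliptope n) → outer t ≋ combination c P →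
    ∀ i → ¬ (c i ≈ 0#) → outer t ≋ P i
  outer-extreme {k = k} t {c} {P} 0≤c Σc≈1 P∈E t≋cP i ci≉0 e = begin
    o                ≈⟨ *-identityʳ o ⟨
    o * 1#           ≈⟨ *-congˡ (x-y≈0⇒x≈y gap≈0) ⟩
    o * (o * P i e)  ≈⟨ *-assoc o o (P i e) ⟨
    o * o * P i e    ≈⟨ trans (*-congʳ (outer-square t e)) (*-identityˡ _) ⟩
    P i e            ∎
    where
    o = outer t e

    Σgap≈0 : ∑[ j < k ] (c j * (1# - o * P j e)) ≈ 0#
    Σgap≈0 = begin
      ∑[ j < k ] (c j * (1# - o * P j e))
        ≈⟨ sum-cong (λ j → solve 3 (λ c o p → c :* (:1 :- o :* p) := c :- o :* (c :* p)) refl (c j) o (P j e)) ⟩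
      ∑[ j < k ] (c j - o * (c j * P j e))
        ≈⟨ sum-sub c (λ j → o * (c j * P j e)) ⟩
      sum c - ∑[ j < k ] (o * (c j * P j e))
        ≈⟨ +-cong Σc≈1 (-‿cong (sym (*-distribˡ-sum o (λ j → c j * P j e)))) ⟩
      1# - o * combination c P e
        ≈⟨ +-congˡ (-‿cong (trans (*-congˡ (sym (t≋cP e))) (outer-square t e))) ⟩
      1# - 1#
        ≈⟨ -‿inverseʳ 1# ⟩
      0# ∎

    gap≈0 : 1# - o * P i e ≈ 0#
    gap≈0 = *-cancelˡ-0 ci≉0 (sum-nonneg-0
      (λ j → *-nonneg (0≤c j) (≤⇒0≤- (entry-bound (P∈E j) t e))) Σgap≈0 i)

  some-extreme : ∀ {n k} (t : SignVector n) {c : Fin k → Carrier} {P : Fin k → Matrix n} →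
    (∀ i → 0# ≤ c i) → sum c ≈ 1# → (∀ i → P i ∈ Elliptope n) → outer t ≋ combination c P →
    ∃ λ i → outer t ≋ P i
  some-extreme t {c} 0≤c Σc≈1 P∈E t≋cP
    with nonzero-term c (λ Σc≈0 → 0≉1 (trans (sym Σc≈0) Σc≈1))
  ... | i , ci≉0 = i , outer-extreme t 0≤c Σc≈1 P∈E t≋cP i ci≉0

  -- Membership in `conv` allows any number of points and repetitions; pushing the weights forward
  -- along the choice of indices normalises them to one weight per generator.
  hull-coefficients : ∀ {I k} {p : Fin k → Space I} {x} → x ∈ conv (range p) →
    ∃ λ c → (∀ i → 0# ≤ c i) × sum c ≈ 1# × x ≋ combination c p
  hull-coefficients {p = p} (_ , q , c , q∈p , 0≤c , Σc≈1 , x≋cq) =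
    pushforward ρ c , pushforward-nonneg ρ 0≤c , trans (sum-pushforward-1 ρ c) Σc≈1 ,
    λ a → trans (x≋cq a) (trans (combination-congʳ c (proj₂ ∘ q∈p) a)
      (sym (combination-pushforward ρ c p a)))
    where
    ρ = λ i → proj₁ (q∈p i)

  in-hull : ∀ {I k} {p : Fin k → Space I} {x} c → (∀ i → 0# ≤ c i) → sum c ≈ 1# →
    x ≋ combination c p → x ∈ conv (range p)
  in-hull {k = k} {p} c 0≤c Σc≈1 x≋cp = k , p , c , (λ i → i , λ _ → refl) , 0≤c , Σc≈1 , x≋cp

  vertex∈hull : ∀ {I k} (p : Fin k → Space I) i → p i ∈ conv (range p)
  vertex∈hull p i = in-hull (δ i) (δ-nonneg i) (sum-δ-1 i) (λ a → sym (combination-δ i p a))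

  hull-resp : ∀ {I} (P : Pred (Space I) _) {x y} → x ≋ y → x ∈ conv P → y ∈ conv P
  hull-resp P x≋y (k , q , c , q∈P , 0≤c , Σc≈1 , x≋cq) =
    k , q , c , q∈P , 0≤c , Σc≈1 , λ a → trans (sym (x≋y a)) (x≋cq a)

  hull-convex : ∀ {I k} (p : Fin k → Space I) → Convex (conv (range p))
  hull-convex p x y τ x∈ y∈ 0≤τ τ≤1 with hull-coefficients x∈ | hull-coefficients y∈
  ... | c , 0≤c , Σc≈1 , x≋cp | d , 0≤d , Σd≈1 , y≋dp =
    in-hull (λ i → τ * c i + (1# - τ) * d i)
      (λ i → +-nonneg (*-nonneg 0≤τ (0≤c i)) (*-nonneg (≤⇒0≤- τ≤1) (0≤d i)))
      (begin
        _ ≈⟨ sum-lin τ (1# - τ) c d ⟩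
        τ * sum c + (1# - τ) * sum d ≈⟨ +-cong (*-congˡ Σc≈1) (*-congˡ Σd≈1) ⟩
        τ * 1# + (1# - τ) * 1# ≈⟨ solve 1 (λ τ → τ :* :1 :+ (:1 :- τ) :* :1 := :1) refl τ ⟩
        1# ∎)
      (λ a → trans (+-cong (*-congˡ (x≋cp a)) (*-congˡ (y≋dp a)))
        (sym (combination-lin τ (1# - τ) c d p a)))

  coefficients-unique : ∀ {I k} {p : Fin k → Space I} → AffinelyIndependent p → ∀ c d →
    sum c ≈ sum d → combination c p ≋ combination d p → ∀ i → c i ≈ d i
  coefficients-unique {p = p} independent c d Σc≈Σd cp≋dp i = x-y≈0⇒x≈y
    (independent (λ i → c i - d i) (trans (sum-sub c d) (x≈y⇒x-y≈0 Σc≈Σd))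
      (λ a → trans (combination-sub c d p a) (x≈y⇒x-y≈0 (cp≋dp a))) i)

  cutHull⊆elliptope : ∀ {n r} (s : Fin r → SignVector n) → cutHull s ⊆ Elliptope n
  cutHull⊆elliptope s x∈F with hull-coefficients x∈F
  ... | c , 0≤c , Σc≈1 , x≋ = elliptope-resp (λ e → sym (x≋ e))
    (elliptope-combination 0≤c Σc≈1 (λ i → outer∈elliptope (s i)))

-- Enumeration of the pairs `i < j` in `Fin r`.

triangle : ℕ → ℕ
triangle zero    = 0
triangle (suc r) = r ℕ.+ triangle r

C2≡triangle : ∀ r → r C 2 ≡ triangle r
C2≡triangle zero    = ≡.refl
C2≡triangle (suc r) = ≡.trans (≡.sym (nCk+nC[k+1]≡[n+1]C[k+1] r 1))
  (≡.cong₂ ℕ._+_ (nC1≡n r) (C2≡triangle r))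

-- Pairs containing `zero` come first and the shifted pairs of the smaller index set follow,
-- matching the two summands of `triangle`, so that sums over pairs split by recursion on `r`.
pair : ∀ r → Fin (triangle r) → Fin r × Fin r
pair (suc r) t with splitAt r t
... | inj₁ j = zero , suc j
... | inj₂ u = Product.map suc suc (pair r u)

pair-↑ˡ : ∀ r j → pair (suc r) (j ↑ˡ triangle r) ≡ (zero , suc j)
pair-↑ˡ r j rewrite Fin.splitAt-↑ˡ r j (triangle r) = ≡.refl

pair-↑ʳ : ∀ r u → pair (suc r) (r ↑ʳ u) ≡ Product.map suc suc (pair r u)
pair-↑ʳ r u rewrite Fin.splitAt-↑ʳ r (triangle r) u = ≡.refl

pair-≢ : ∀ r t → proj₁ (pair r t) ≢ proj₂ (pair r t)
pair-≢ (suc r) t with splitAt r t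
... | inj₁ j = λ ()
... | inj₂ u = λ e → pair-≢ r u (Fin.suc-injective e)

pair-surjective : ∀ r (i j : Fin r) → i ≢ j → ∃ λ t → pair r t ≡ (i , j) ⊎ pair r t ≡ (j , i)
pair-surjective (suc r) zero    zero    i≢j = contradiction ≡.refl i≢j
pair-surjective (suc r) zero    (suc j) i≢j = j ↑ˡ triangle r , inj₁ (pair-↑ˡ r j)
pair-surjective (suc r) (suc i) zero    i≢j = i ↑ˡ triangle r , inj₂ (pair-↑ˡ r i)
pair-surjective (suc r) (suc i) (suc j) i≢j with pair-surjective r i j (i≢j ∘ ≡.cong suc)
... | t , inj₁ e = r ↑ʳ t , inj₁ (≡.trans (pair-↑ʳ r t) (≡.cong (Product.map suc suc) e))
... | t , inj₂ e = r ↑ʳ t , inj₂ (≡.trans (pair-↑ʳ r t) (≡.cong (Product.map suc suc) e))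

-- Schur products: generators, coefficient matrices and the dimension count.

module SchurProducts (ℝ : RealNumbers) where

  open RealNumbers ℝ hiding (zero)
  open OrderedField ℝ
  open Geometry ℝ
  open FiniteSums ℝ
  open LinearAlgebra ℝ
  open Elliptopes ℝ
  open SetoidReasoning setoid

  sum-split : ∀ m k (h : Fin (m ℕ.+ k) → Carrier) →
    sum h ≈ ∑[ i < m ] h (i ↑ˡ k) + ∑[ j < k ] h (m ↑ʳ j)
  sum-split zero    k h = sym (+-identityˡ _)
  sum-split (suc m) k h = trans (+-congˡ (sum-split m k (h ∘ suc))) (sym (+-assoc _ _ _))

  symmetrised : ∀ {r} → (Fin r → Fin r → Carrier) → Fin r × Fin r → Carrier
  symmetrised f (i , j) = f i j + f j i

  -- Beyond the corner, the first row and the first column together run through the pairs containing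
  -- `zero`; the remaining block is treated by induction.
  sum-pairs : ∀ r (f : Fin r → Fin r → Carrier) →
    ∑[ i < r ] ∑[ j < r ] f i j ≈ ∑[ i < r ] f i i + ∑[ t < triangle r ] symmetrised f (pair r t)
  sum-pairs zero    f = sym (+-identityˡ _)
  sum-pairs (suc r) f = begin
    (f zero zero + R) + ∑[ i < r ] (f (suc i) zero + ∑[ j < r ] f (suc i) (suc j))
      ≈⟨ +-congˡ (∑-distrib-+ (λ i → f (suc i) zero) (λ i → ∑[ j < r ] f (suc i) (suc j))) ⟩
    (f zero zero + R) + (L + ∑[ i < r ] ∑[ j < r ] f (suc i) (suc j))
      ≈⟨ +-congˡ (+-congˡ (sum-pairs r (λ i j → f (suc i) (suc j)))) ⟩
    (f zero zero + R) + (L + (D + P))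
      ≈⟨ solve 5 (λ z R L D P → (z :+ R) :+ (L :+ (D :+ P)) := (z :+ D) :+ ((R :+ L) :+ P)) refl
           (f zero zero) R L D P ⟩
    (f zero zero + D) + ((R + L) + P)
      ≈⟨ +-congˡ (+-congʳ (∑-distrib-+ (λ j → f zero (suc j)) (λ j → f (suc j) zero))) ⟨
    (f zero zero + D) + (∑[ j < r ] (f zero (suc j) + f (suc j) zero) + P)
      ≈⟨ +-congˡ (+-cong
           (sum-cong (λ j → reflexive (≡.cong (symmetrised f) (pair-↑ˡ r j))))
           (sum-cong (λ u → reflexive (≡.cong (symmetrised f) (pair-↑ʳ r u))))) ⟨
    (f zero zero + D) + (∑[ j < r ] symmetrised f (pair (suc r) (j ↑ˡ triangle r))
      + ∑[ u < triangle r ] symmetrised f (pair (suc r) (r ↑ʳ u)))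
      ≈⟨ +-congˡ (sum-split r (triangle r) (symmetrised f ∘ pair (suc r))) ⟨
    (f zero zero + D) + ∑[ t < triangle (suc r) ] symmetrised f (pair (suc r) t) ∎
    where
    R = ∑[ j < r ] f zero (suc j)
    L = ∑[ i < r ] f (suc i) zero
    D = ∑[ i < r ] f (suc i) (suc i)
    P = ∑[ t < triangle r ] symmetrised (λ i j → f (suc i) (suc j)) (pair r t)

  -- Places the coefficient `c t` at the entry `pair r t`, so that a linear relation among the
  -- generators becomes a matrix to which `SchurFree` applies.
  upperTriangular : ∀ r → (Fin (triangle r) → Carrier) → Fin r → Fin r → Carrier
  upperTriangular (suc r) c zero    zero    = 0#
  upperTriangular (suc r) c zero    (suc j) = c (j ↑ˡ triangle r)
  upperTriangular (suc r) c (suc i) zero    = 0#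
  upperTriangular (suc r) c (suc i) (suc j) = upperTriangular r (c ∘ (r ↑ʳ_)) i j

  upperTriangular-diagonal : ∀ r c i → upperTriangular r c i i ≈ 0#
  upperTriangular-diagonal (suc r) c zero    = refl
  upperTriangular-diagonal (suc r) c (suc i) = upperTriangular-diagonal r _ i

  upperTriangular-pair : ∀ r c t → symmetrised (upperTriangular r c) (pair r t) ≈ c t
  upperTriangular-pair (suc r) c t with splitAt r t in eq
  ... | inj₁ j = trans (+-identityʳ _) (reflexive (≡.cong c (Fin.splitAt⁻¹-↑ˡ eq)))
  ... | inj₂ u = trans (upperTriangular-pair r _ u) (reflexive (≡.cong c (Fin.splitAt⁻¹-↑ʳ eq)))

  δδ-≢ : ∀ {n} (k : Fin n) {i j} → i ≢ j → δ k i * δ k j ≈ 0#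
  δδ-≢ k {i} {j} i≢j with k Fin.≟ i
  ... | yes ≡.refl = trans (*-congˡ (δ-≢ i≢j)) (zeroʳ _)
  ... | no  k≢i    = trans (*-congʳ (δ-≢ k≢i)) (zeroˡ _)

  -- Schur independence in matrix form: a quadratic form in the sign vectors that
  -- vanishes coordinatewise has zero trace and zero mixed terms.
  SchurFree : ∀ {n r} → (Fin r → SignVector n) → Set
  SchurFree {r = r} s = ∀ (B : Fin r → Fin r → Carrier) →
    (∀ a → ∑[ i < r ] ∑[ j < r ] (B i j * schurProducts s (i , j) a) ≈ 0#) →
    ∑[ i < r ] B i i ≈ 0# × (∀ i j → i ≢ j → B i j + B j i ≈ 0#)

  module _ {n r} (s : Fin r → SignVector n) where

    -- The family `𝐞` and `sᵢ⊙sⱼ` for `i < j` of the second description of Schur independence. All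
    -- diagonal products coincide with `𝐞`, and commutativity removes the pairs with `i > j`.
    generator : Fin (suc (triangle r)) → Space (Fin n)
    generator zero    _ = 1#
    generator (suc t)   = schurProducts s (pair r t)

    schurProducts-diagonal : ∀ i a → schurProducts s (i , i) a ≈ 1#
    schurProducts-diagonal i a = ⟦⟧ˢ-square (lookup (s i) a)

    schurProduct∈generators : ∀ e → ∃ λ t → schurProducts s e ≋ generator t
    schurProduct∈generators (i , j) with i Fin.≟ j
    ... | yes ≡.refl = zero , schurProducts-diagonal i
    ... | no  i≢j with pair-surjective r i j i≢j
    ... | t , inj₁ e = suc t , λ a → reflexive (≡.cong (λ e → schurProducts s e a) (≡.sym e))
    ... | t , inj₂ e = suc t , λ a → trans (*-comm _ _)
      (reflexive (≡.cong (λ e → schurProducts s e a) (≡.sym e)))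

    -- The index supplies a diagonal product to represent `𝐞`; without any sign vector there would
    -- be none.
    generator∈schurProducts : Fin r → ∀ t → ∃ λ e → generator t ≋ schurProducts s e
    generator∈schurProducts i zero    = (i , i) , λ a → sym (schurProducts-diagonal i a)
    generator∈schurProducts i (suc t) = pair r t , λ _ → refl

    span-generators : ∀ {x} → x ∈ span (range (schurProducts s)) → ∃ λ c → x ≋ combination c generator
    span-generators (k , q , c , q∈ , x≋cq) = pushforward ρ c , λ a → trans (x≋cq a)
      (trans (combination-congʳ c q≋ a) (sym (combination-pushforward ρ c generator a)))
      where
      ρ : Fin k → Fin (suc (triangle r))
      ρ i = proj₁ (schurProduct∈generators (proj₁ (q∈ i)))

      q≋ : ∀ i → q i ≋ generator (ρ i)
      q≋ i a = trans (proj₂ (q∈ i) a) (proj₂ (schurProduct∈generators (proj₁ (q∈ i))) a)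

    generator-coefficients : (Fin r → Fin r → Carrier) → Fin (suc (triangle r)) → Carrier
    generator-coefficients B zero    = ∑[ i < r ] B i i
    generator-coefficients B (suc t) = symmetrised B (pair r t)

    -- Collapsing the diagonal products to `𝐞` leaves the trace of `B` as its coefficient, and
    -- commuting factors leave the symmetrised off-diagonal entries.
    schurProducts-sum : ∀ B a → ∑[ i < r ] ∑[ j < r ] (B i j * schurProducts s (i , j) a) ≈
                        combination (generator-coefficients B) generator a
    schurProducts-sum B a = trans (sum-pairs r f) (+-cong
      (trans (sum-cong (λ i → trans (*-congˡ (schurProducts-diagonal i a)) (*-identityʳ (B i i))))
             (sym (*-identityʳ _)))
      (sum-cong (λ t → let (i , j) = pair r t in
        trans (+-congˡ (*-congˡ (*-comm (⟦ s j ⟧ a) (⟦ s i ⟧ a)))) (sym (distribʳ _ (B i j) (B j i))))))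
      where
      f : Fin r → Fin r → Carrier
      f i j = B i j * schurProducts s (i , j) a

    dimension : r C 2 ℕ.+ 1 ≡ suc (triangle r)
    dimension = ≡.trans (ℕ.+-comm (r C 2) 1) (≡.cong suc (C2≡triangle r))

    -- The given basis is arbitrary, but it has as many members as there are generators and lies in
    -- their span, so the generators are independent and the collapsed coefficients of `B` vanish.
    independent⇒free : SchurIndependent s → SchurFree s
    independent⇒free schur B ΣΣ≈0
      with ≡.subst (HasDimension (span (range (schurProducts s)))) dimension schur
    ... | b , b-independent , span-b⊆W , _ = coefficients≈0 zero , mixed
      where
      b∈W : ∀ i → b i ∈ span (range (schurProducts s))
      b∈W i = span-b⊆W (_ , b , δ i , (λ j → j , λ _ → refl) , λ a → sym (combination-δ i b a))

      coefficients≈0 : ∀ t → generator-coefficients B t ≈ 0#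
      coefficients≈0 = generators-independent b generator b-independent (λ i → span-generators (b∈W i))
        (generator-coefficients B) (λ a → trans (sym (schurProducts-sum B a)) (ΣΣ≈0 a))

      mixed : ∀ i j → i ≢ j → B i j + B j i ≈ 0#
      mixed i j i≢j with pair-surjective r i j i≢j
      ... | t , inj₁ e = trans (reflexive (≡.cong (symmetrised B) (≡.sym e))) (coefficients≈0 (suc t))
      ... | t , inj₂ e = trans (+-comm _ _)
        (trans (reflexive (≡.cong (symmetrised B) (≡.sym e))) (coefficients≈0 (suc t)))

    free⇒independent : Fin r → SchurFree s → SchurIndependent s
    free⇒independent k free = ≡.subst (HasDimension (span (range (schurProducts s)))) (≡.sym dimension)
      (generator , generator-independent ,
       (λ (m , q , c , q∈ , x≋) → m , q , c ,
          (λ i → let (t , q≋) = q∈ i; (e , g≋) = generator∈schurProducts k t in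
             e , λ a → trans (q≋ a) (g≋ a)) , x≋) ,
       (λ (m , q , c , q∈ , x≋) → m , q , c ,
          (λ i → let (e , q≋) = q∈ i; (t , g≋) = schurProduct∈generators e in
             t , λ a → trans (q≋ a) (g≋ a)) , x≋))
      where
      module _ (c : Fin (suc (triangle r)) → Carrier) where

        U = upperTriangular r (c ∘ suc)

        -- The coefficient of `𝐞` has to appear as a trace; it is put on the single diagonal entry
        -- at `k`, the rest of the diagonal being zero.
        B : Fin r → Fin r → Carrier
        B i j = U i j + δ k i * δ k j * c zero

        B-diagonal : ∀ i → B i i ≈ δ k i * (δ k i * c zero)
        B-diagonal i = trans (+-congʳ (upperTriangular-diagonal r (c ∘ suc) i))
          (trans (+-identityˡ _) (*-assoc _ _ _))

        B-off-diagonal : ∀ {i j} → i ≢ j → B i j ≈ U i j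
        B-off-diagonal i≢j = trans (+-congˡ (trans (*-congʳ (δδ-≢ k i≢j)) (zeroˡ _))) (+-identityʳ _)

        coefficients : ∀ t → generator-coefficients B t ≈ c t
        coefficients zero = begin
          ∑[ i < r ] B i i                      ≈⟨ sum-cong B-diagonal ⟩
          ∑[ i < r ] (δ k i * (δ k i * c zero)) ≈⟨ sum-δ k (λ i → δ k i * c zero) ⟩
          δ k k * c zero                        ≈⟨ trans (*-congʳ (δ-refl k)) (*-identityˡ _) ⟩
          c zero                                ∎
        coefficients (suc t) = trans
          (+-cong (B-off-diagonal (pair-≢ r t)) (B-off-diagonal (pair-≢ r t ∘ ≡.sym)))
          (upperTriangular-pair r (c ∘ suc) t)

      generator-independent : LinearlyIndependent generator
      generator-independent c cg≈0 t = trans (sym (coefficients c t)) (zeros t)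
        where
        traceAndMixed = free (B c) (λ a → trans (schurProducts-sum (B c) a)
          (trans (combination-congˡ generator (coefficients c) a) (cg≈0 a)))

        zeros : ∀ t → generator-coefficients (B c) t ≈ 0#
        zeros zero    = proj₁ traceAndMixed
        zeros (suc t) = proj₂ traceAndMixed _ _ (pair-≢ r t)

-- From Schur independence to a simplicial face.

module SchurFaces (ℝ : RealNumbers) where

  open RealNumbers ℝ hiding (zero)
  open OrderedField ℝ
  open Geometry ℝ
  open FiniteSums ℝ
  open LinearAlgebra ℝ
  open Elliptopes ℝ
  open SchurProducts ℝ
  open SetoidReasoning setoid

  signs : ∀ {n r} → (Fin r → SignVector n) → Fin r → Space (Fin n)
  signs s i = ⟦ s i ⟧

  -- The matrix `S G Sᵗ`, where `S` has the sign vectors as columns. Its diagonal is the combination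
  -- of Schur products that occurs in `SchurFree`.
  gram : ∀ {n r} → (Fin r → Fin r → Carrier) → (Fin r → SignVector n) → Matrix n
  gram {r = r} G s (a , b) = ∑[ i < r ] ∑[ j < r ] (G i j * (⟦ s i ⟧ a * ⟦ s j ⟧ b))

  bilinear-gram : ∀ {n r} (G : Fin r → Fin r → Carrier) (s : Fin r → SignVector n) u v →
    bilinear (gram G s) u v ≈ ∑[ i < r ] ∑[ j < r ] (G i j * ((u · ⟦ s i ⟧) * (⟦ s j ⟧ · v)))
  bilinear-gram {r = r} G s u v = begin
    bilinear (gram G s) u v
      ≈⟨ bilinear-cong (λ e → sum-cong (λ i → sym (*-identityˡ (combination (G i) (P i) e)))) u v ⟩
    bilinear (combination (λ _ → 1#) (λ i → combination (G i) (P i))) u v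
      ≈⟨ bilinear-combination (λ _ → 1#) (λ i → combination (G i) (P i)) u v ⟩
    ∑[ i < r ] (1# * bilinear (combination (G i) (P i)) u v)
      ≈⟨ sum-cong (λ i → trans (*-identityˡ _) (trans (bilinear-combination (G i) (P i) u v)
           (sum-cong (λ j → *-congˡ (bilinear-rank-one ⟦ s i ⟧ ⟦ s j ⟧ u v))))) ⟩
    ∑[ i < r ] ∑[ j < r ] (G i j * ((u · ⟦ s i ⟧) * (⟦ s j ⟧ · v))) ∎
    where
    P : Fin r → Fin r → Matrix _
    P i j (a , b) = ⟦ s i ⟧ a * ⟦ s j ⟧ b

  diagonal-sum : ∀ {r} {f : Fin r → Fin r → Carrier} → (∀ i j → i ≢ j → f i j ≈ 0#) →
    ∑[ i < r ] ∑[ j < r ] f i j ≈ ∑[ i < r ] f i i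
  diagonal-sum {r} {f} off≈0 = sum-cong (λ i → trans (sum-cong (row i)) (sum-δ i (f i)))
    where
    row : ∀ i j → f i j ≈ δ i j * f i j
    row i j with i Fin.≟ j
    ... | yes ≡.refl = sym (trans (*-congʳ (δ-refl i)) (*-identityˡ _))
    ... | no  i≢j    = trans (off≈0 i j i≢j) (sym (trans (*-congʳ (δ-≢ i≢j)) (zeroˡ _)))

  diagonal-gram : ∀ {n r} {G : Fin r → Fin r → Carrier} (s : Fin r → SignVector n) →
    (∀ i j → i ≢ j → G i j ≈ 0#) → gram G s ≋ combination (λ i → G i i) (λ i → outer (s i))
  diagonal-gram s off≈0 e = diagonal-sum (λ i j i≢j → trans (*-congʳ (off≈0 i j i≢j)) (zeroˡ _))

  module _ {n r} (s : Fin r → SignVector n) {w : Fin r → Space (Fin n)} (dual : Dual (signs s) w) where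

    -- Duality makes `Wᵗ S` the identity, so `Wᵗ (S G Sᵗ) W` is `G`: the matrix determines its
    -- coefficients.
    bilinear-gram-dual : ∀ G i j → bilinear (gram G s) (w i) (w j) ≈ G i j
    bilinear-gram-dual G i j = begin
      bilinear (gram G s) (w i) (w j)
        ≈⟨ bilinear-gram G s (w i) (w j) ⟩
      ∑[ k < r ] ∑[ l < r ] (G k l * ((w i · ⟦ s k ⟧) * (⟦ s l ⟧ · w j)))
        ≈⟨ sum-cong (λ k → sum-cong (λ l → *-congˡ (*-cong (trans (·-comm (w i) ⟦ s k ⟧) (dual k i)) (dual l j)))) ⟩
      ∑[ k < r ] ∑[ l < r ] (G k l * (δ k i * δ l j))
        ≈⟨ sum-cong (λ k → sum-cong (λ l →
             solve 3 (λ g x y → g :* (x :* y) := g :* y :* x) refl (G k l) (δ k i) (δ l j))) ⟩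
      ∑[ k < r ] ∑[ l < r ] (G k l * δ l j * δ k i)
        ≈⟨ sum-cong (λ k → *-distribʳ-sum (δ k i) (λ l → G k l * δ l j)) ⟨
      ∑[ k < r ] (∑[ l < r ] (G k l * δ l j) * δ k i)
        ≈⟨ sum-cong (λ k → *-congʳ (sum-δʳ j (G k))) ⟩
      ∑[ k < r ] (G k j * δ k i)
        ≈⟨ sum-δʳ i (λ k → G k j) ⟩
      G i j ∎

    -- A combination of the rank-one matrices is `S G Sᵗ` with `G` diagonal, and the dual family
    -- reads the diagonal back.
    outers-independent : LinearlyIndependent (λ i → outer (s i))
    outers-independent c cO≈0 i = begin
      c i
        ≈⟨ trans (*-congʳ (δ-refl i)) (*-identityˡ (c i)) ⟨
      G i i
        ≈⟨ bilinear-gram-dual G i i ⟨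
      bilinear (gram G s) (w i) (w i)
        ≈⟨ bilinear-cong (λ e → trans (diagonal-gram s (λ i j i≢j → trans (*-congʳ (δ-≢ i≢j)) (zeroˡ _)) e)
             (trans (combination-congˡ (λ i → outer (s i)) (λ i → trans (*-congʳ (δ-refl i)) (*-identityˡ (c i))) e)
               (cO≈0 e))) (w i) (w i) ⟩
      bilinear 𝟘 (w i) (w i)
        ≈⟨ sum-0 (λ a → sum-0 (λ b → trans (*-congʳ (zeroʳ (w i a))) (zeroˡ (w i b)))) ⟩
      0# ∎
      where
      G : Fin r → Fin r → Carrier
      G i j = δ i j * c i

    -- u minus its components along the dual family is orthogonal to every sign
    -- vector, so X only sees those components.
    kernel⇒gram : ∀ {X} → Symmetric X →
      (∀ v → (∀ i → ⟦ s i ⟧ · v ≈ 0#) → ∀ u → bilinear X u v ≈ 0#) →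
      X ≋ gram (λ i j → bilinear X (w i) (w j)) s
    kernel⇒gram {X} symmetric kernel (a , b) = begin
      X (a , b)
        ≈⟨ bilinear-δ X a b ⟨
      bilinear X (δ a) (δ b)
        ≈⟨ expand (δ a) (δ b) ⟩
      ∑[ j < r ] ((⟦ s j ⟧ · δ b) * bilinear X (δ a) (w j))
        ≈⟨ sum-cong (λ j → *-cong (·-δ ⟦ s j ⟧ b)
             (trans (bilinear-sym symmetric (δ a) (w j)) (expand (w j) (δ a)))) ⟩
      ∑[ j < r ] (⟦ s j ⟧ b * ∑[ i < r ] ((⟦ s i ⟧ · δ a) * bilinear X (w j) (w i)))
        ≈⟨ sum-cong (λ j → *-congˡ (sum-cong (λ i → *-cong (·-δ ⟦ s i ⟧ a) (bilinear-sym symmetric (w j) (w i))))) ⟩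
      ∑[ j < r ] (⟦ s j ⟧ b * ∑[ i < r ] (⟦ s i ⟧ a * B i j))
        ≈⟨ sum-cong (λ j → *-distribˡ-sum (⟦ s j ⟧ b) (λ i → ⟦ s i ⟧ a * B i j)) ⟩
      ∑[ j < r ] ∑[ i < r ] (⟦ s j ⟧ b * (⟦ s i ⟧ a * B i j))
        ≈⟨ sum-cong (λ j → sum-cong (λ i → solve 3 (λ x y g → y :* (x :* g) := g :* (x :* y)) refl
             (⟦ s i ⟧ a) (⟦ s j ⟧ b) (B i j))) ⟩
      ∑[ j < r ] ∑[ i < r ] (B i j * (⟦ s i ⟧ a * ⟦ s j ⟧ b))
        ≈⟨ ∑-comm (λ j i → B i j * (⟦ s i ⟧ a * ⟦ s j ⟧ b)) ⟩
      gram B s (a , b) ∎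
      where
      B : Fin r → Fin r → Carrier
      B i j = bilinear X (w i) (w j)

      ·-δ : ∀ (x : Space (Fin n)) b → x · δ b ≈ x b
      ·-δ x b = trans (·-comm x (δ b)) (sum-δ b x)

      expand : ∀ u v → bilinear X u v ≈ ∑[ j < r ] ((⟦ s j ⟧ · v) * bilinear X u (w j))
      expand u v = x-y≈0⇒x≈y (begin
        bilinear X u v - ∑[ j < r ] (k j * bilinear X u (w j))
          ≈⟨ +-congˡ (-‿cong (bilinear-combinationʳ X u k w)) ⟨
        bilinear X u v - bilinear X u (combination k w)
          ≈⟨ solve 2 (λ x y → x :- y := :1 :* x :+ (:- :1) :* y) refl _ _ ⟩
        1# * bilinear X u v + - 1# * bilinear X u (combination k w)
          ≈⟨ bilinear-linʳ X u 1# (- 1#) v (combination k w) ⟨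
        bilinear X u v⊥
          ≈⟨ kernel v⊥ orthogonal u ⟩
        0# ∎)
        where
        k : Fin r → Carrier
        k j = ⟦ s j ⟧ · v

        v⊥ : Space (Fin n)
        v⊥ a = 1# * v a + - 1# * combination k w a

        orthogonal : ∀ i → ⟦ s i ⟧ · v⊥ ≈ 0#
        orthogonal i = begin
          ⟦ s i ⟧ · v⊥
            ≈⟨ ·-lin ⟦ s i ⟧ 1# (- 1#) v (combination k w) ⟩
          1# * k i + - 1# * (⟦ s i ⟧ · combination k w)
            ≈⟨ +-congˡ (*-congˡ (·-combination ⟦ s i ⟧ k w)) ⟩
          1# * k i + - 1# * ∑[ j < r ] (k j * (⟦ s i ⟧ · w j))
            ≈⟨ +-congˡ (*-congˡ (sum-cong (λ j → *-congˡ {x = k j} (trans (dual i j) (δ-sym i j))))) ⟩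
          1# * k i + - 1# * ∑[ j < r ] (k j * δ j i)
            ≈⟨ +-congˡ (*-congˡ (sum-δʳ i k)) ⟩
          1# * k i + - 1# * k i
            ≈⟨ solve 1 (λ x → :1 :* x :+ (:- :1) :* x := :0) refl (k i) ⟩
          0# ∎

  module _ {n r} (s : Fin r → SignVector n) (k : Fin r) (free : SchurFree s) where

    -- Multiplying a linear relation coordinatewise by `s k` gives a relation among Schur products
    -- whose matrix has the coefficients in row `k` and zeros elsewhere. Its trace is `c k`, and its
    -- mixed terms with `k` are the other coefficients.
    signs-independent : LinearlyIndependent (signs s)
    signs-independent c cs≈0 = c≈0
      where
      B : Fin r → Fin r → Carrier
      B i j = δ k i * c j

      traceAndMixed = free B (λ a → sum-0 (λ i → begin
        ∑[ j < r ] (δ k i * c j * (⟦ s i ⟧ a * ⟦ s j ⟧ a))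
          ≈⟨ sum-cong (λ j → solve 4 (λ d c x y → d :* c :* (x :* y) := d :* x :* (c :* y)) refl
               (δ k i) (c j) (⟦ s i ⟧ a) (⟦ s j ⟧ a)) ⟩
        ∑[ j < r ] (δ k i * ⟦ s i ⟧ a * (c j * ⟦ s j ⟧ a))
          ≈⟨ *-distribˡ-sum (δ k i * ⟦ s i ⟧ a) (λ j → c j * ⟦ s j ⟧ a) ⟨
        δ k i * ⟦ s i ⟧ a * combination c (signs s) a
          ≈⟨ trans (*-congˡ (cs≈0 a)) (zeroʳ _) ⟩
        0# ∎))

      c≈0 : ∀ i → c i ≈ 0#
      c≈0 i with k Fin.≟ i
      ... | yes ≡.refl = trans (sym (sum-δ k c)) (proj₁ traceAndMixed)
      ... | no  k≢i    = begin
        c i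
          ≈⟨ solve 2 (λ x y → x := :1 :* x :+ :0 :* y) refl (c i) (c k) ⟩
        1# * c i + 0# * c k
          ≈⟨ +-cong (*-congʳ (δ-refl k)) (*-congʳ (δ-≢ k≢i)) ⟨
        B k i + B i k
          ≈⟨ proj₂ traceAndMixed k i k≢i ⟩
        0# ∎

    dual-signs : ∃ (Dual (signs s))
    dual-signs = dual-family (signs s) signs-independent

    -- The matrix unit at `k` also produces a unit diagonal, that of `outer (s k)`. Subtracting it
    -- from `B` leaves a relation that vanishes coordinatewise, so `SchurFree` gives trace 1 and, by
    -- symmetry of `B` and division by 2, zero off-diagonal entries.
    gram∈hull : ∀ {B : Fin r → Fin r → Carrier} → (∀ i j → B i j ≈ B j i) → (∀ i → 0# ≤ B i i) →
      UnitDiagonal (gram B s) → gram B s ∈ cutHull s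
    gram∈hull {B} symmetric 0≤diagonal unit =
      in-hull (λ i → B i i) 0≤diagonal trace (diagonal-gram s off≈0)
      where
      B′ : Fin r → Fin r → Carrier
      B′ i j = B i j - δ k i * δ k j

      ΣΣδδ : ∀ a → ∑[ i < r ] ∑[ j < r ] (δ k i * δ k j * (⟦ s i ⟧ a * ⟦ s j ⟧ a)) ≈ 1#
      ΣΣδδ a = begin
        ∑[ i < r ] ∑[ j < r ] (δ k i * δ k j * (⟦ s i ⟧ a * ⟦ s j ⟧ a))
          ≈⟨ sum-cong (λ i → trans
               (sum-cong (λ j → *-assoc (δ k i) (δ k j) (⟦ s i ⟧ a * ⟦ s j ⟧ a)))
               (trans (sym (*-distribˡ-sum (δ k i) (λ j → δ k j * (⟦ s i ⟧ a * ⟦ s j ⟧ a))))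
                 (*-congˡ (sum-δ k (λ j → ⟦ s i ⟧ a * ⟦ s j ⟧ a))))) ⟩
        ∑[ i < r ] (δ k i * (⟦ s i ⟧ a * ⟦ s k ⟧ a))
          ≈⟨ sum-δ k (λ i → ⟦ s i ⟧ a * ⟦ s k ⟧ a) ⟩
        ⟦ s k ⟧ a * ⟦ s k ⟧ a
          ≈⟨ ⟦⟧ˢ-square (lookup (s k) a) ⟩
        1# ∎

      traceAndMixed = free B′ (λ a → begin
        ∑[ i < r ] ∑[ j < r ] (B′ i j * (⟦ s i ⟧ a * ⟦ s j ⟧ a))
          ≈⟨ sum-cong (λ i → trans
               (sum-cong (λ j → solve 3 (λ x y z → (x :- y) :* z := x :* z :- y :* z) refl
                 (B i j) (δ k i * δ k j) (⟦ s i ⟧ a * ⟦ s j ⟧ a)))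
               (sum-sub (λ j → B i j * (⟦ s i ⟧ a * ⟦ s j ⟧ a))
                        (λ j → δ k i * δ k j * (⟦ s i ⟧ a * ⟦ s j ⟧ a)))) ⟩
        ∑[ i < r ] (∑[ j < r ] (B i j * (⟦ s i ⟧ a * ⟦ s j ⟧ a))
          - ∑[ j < r ] (δ k i * δ k j * (⟦ s i ⟧ a * ⟦ s j ⟧ a)))
          ≈⟨ sum-sub (λ i → ∑[ j < r ] (B i j * (⟦ s i ⟧ a * ⟦ s j ⟧ a)))
                     (λ i → ∑[ j < r ] (δ k i * δ k j * (⟦ s i ⟧ a * ⟦ s j ⟧ a))) ⟩
        gram B s (a , a) - ∑[ i < r ] ∑[ j < r ] (δ k i * δ k j * (⟦ s i ⟧ a * ⟦ s j ⟧ a))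
          ≈⟨ x≈y⇒x-y≈0 (trans (unit a) (sym (ΣΣδδ a))) ⟩
        0# ∎)

      trace : ∑[ i < r ] B i i ≈ 1#
      trace = begin
        ∑[ i < r ] B i i
          ≈⟨ x-y≈0⇒x≈y (trans (sym (sum-sub (λ i → B i i) (λ i → δ k i * δ k i))) (proj₁ traceAndMixed)) ⟩
        ∑[ i < r ] (δ k i * δ k i)
          ≈⟨ trans (sum-δ k (δ k)) (δ-refl k) ⟩
        1# ∎

      off≈0 : ∀ i j → i ≢ j → B i j ≈ 0#
      off≈0 i j i≢j = *-cancelˡ-0 {1# + 1#} (λ 2≈0 → <⇒≉ 0<2 (sym 2≈0)) (begin
        (1# + 1#) * B i j
          ≈⟨ solve 1 (λ x → (:1 :+ :1) :* x := (x :- :0) :+ (x :- :0)) refl (B i j) ⟩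
        (B i j - 0#) + (B i j - 0#)
          ≈⟨ +-cong (+-congˡ (-‿cong (δδ-≢ k i≢j))) (+-cong (symmetric j i) (-‿cong (δδ-≢ k (i≢j ∘ ≡.sym)))) ⟨
        B′ i j + B′ j i
          ≈⟨ proj₂ traceAndMixed i j i≢j ⟩
        0# ∎)

    -- The kernel of a psd summand contains the kernel of the sum.
    mix∈hull⇒∈hull : ∀ X Y τ → X ∈ Elliptope n → Y ∈ Elliptope n → 0# < τ → τ < 1# →
      mix τ X Y ∈ cutHull s → X ∈ cutHull s
    mix∈hull⇒∈hull X Y τ (symmetric , unit , psd) (_ , _ , psdʸ) 0<τ τ<1 mix∈F
      with dual-signs | hull-coefficients mix∈F
    ... | w , dual | c , _ , _ , mix≋ = hull-resp (range (λ i → outer (s i))) (λ e → sym (X≋ e))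
      (gram∈hull (λ i j → bilinear-sym symmetric (w i) (w j)) (λ i → psd (w i))
        (λ a → trans (sym (X≋ (a , a))) (unit a)))
      where
      kernel : ∀ v → (∀ i → ⟦ s i ⟧ · v ≈ 0#) → ∀ u → bilinear X u v ≈ 0#
      kernel v v⊥s u = psd-kernel symmetric psd u v (*-cancelˡ-0 (λ τ≈0 → <⇒≉ 0<τ (sym τ≈0))
        (≤-antisym (≤-respʳ mixed≈0 (0≤-⇒≤ (≤-respʳ
          (solve 2 (λ x y → y := x :+ y :- x) refl (τ * bilinear X v v) ((1# - τ) * bilinear Y v v))
          (*-nonneg (≤⇒0≤- (<⇒≤ τ<1)) (psdʸ v)))))
          (*-nonneg (<⇒≤ 0<τ) (psd v))))
        where
        mixed≈0 : τ * bilinear X v v + (1# - τ) * bilinear Y v v ≈ 0#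
        mixed≈0 = begin
          τ * bilinear X v v + (1# - τ) * bilinear Y v v
            ≈⟨ bilinear-mix τ (1# - τ) X Y v v ⟨
          bilinear (mix τ X Y) v v
            ≈⟨ bilinear-cong mix≋ v v ⟩
          bilinear (combination c (λ i → outer (s i))) v v
            ≈⟨ bilinear-combination c (λ i → outer (s i)) v v ⟩
          ∑[ i < r ] (c i * bilinear (outer (s i)) v v)
            ≈⟨ sum-0 (λ i → trans (*-congˡ (trans (bilinear-rank-one ⟦ s i ⟧ ⟦ s i ⟧ v v)
                 (trans (*-congˡ (v⊥s i)) (zeroʳ _)))) (zeroʳ (c i))) ⟩
          0# ∎

      X≋ : X ≋ gram (λ i j → bilinear X (w i) (w j)) s
      X≋ = kernel⇒gram s dual symmetric kernel

    schurFree⇒simplicialFace : IsSimplicialFace (Elliptope n) (cutHull s)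
    schurFree⇒simplicialFace =
      record
        { subset  = cutHull⊆elliptope s
        ; convex  = hull-convex (λ i → outer (s i))
        ; extreme = λ X Y τ X∈E Y∈E 0<τ τ<1 mix∈F →
            mix∈hull⇒∈hull X Y τ X∈E Y∈E 0<τ τ<1 mix∈F ,
            -- The second point is handled by exchanging the two points, which replaces `τ` by
            -- `1 - τ`.
            mix∈hull⇒∈hull Y X (1# - τ) Y∈E X∈E (<⇒0<- τ<1)
              (0<-⇒< (<-respʳ (solve 1 (λ τ → τ := :1 :- (:1 :- τ)) refl τ) 0<τ))
              (hull-resp (range (λ i → outer (s i))) (λ e → solve 3 (λ τ x y → τ :* x :+ (:1 :- τ) :* y :=
                 (:1 :- τ) :* y :+ (:1 :- (:1 :- τ)) :* x) refl τ (X e) (Y e)) mix∈F)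
        } ,
      r , (λ i → outer (s i)) ,
      (λ c _ → outers-independent s (proj₂ dual-signs) c) ,
      (λ x∈F → x∈F) , (λ x∈F → x∈F)

-- Vertices of a simplicial face and uniqueness of sign decompositions.

module SimplicialFaces (ℝ : RealNumbers) where

  open RealNumbers ℝ hiding (zero)
  open OrderedField ℝ
  open Geometry ℝ
  open FiniteSums ℝ
  open LinearAlgebra ℝ
  open Elliptopes ℝ
  open SignDecomposition
  open SetoidReasoning setoid

  ⟦⟧ˢ-* : ∀ x y → ⟦ x ⟧ˢ * ⟦ y ⟧ˢ ≈ ⟦ x Sign.* y ⟧ˢ
  ⟦⟧ˢ-* Sign.+ y      = *-identityˡ _
  ⟦⟧ˢ-* Sign.- Sign.+ = *-identityʳ _
  ⟦⟧ˢ-* Sign.- Sign.- = ⟦⟧ˢ-square Sign.-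

  1≉-1 : ¬ (1# ≈ - 1#)
  1≉-1 1≈-1 = <⇒≉ 0<2 (sym (trans (+-congˡ 1≈-1) (-‿inverseʳ 1#)))

  ⟦⟧ˢ-injective : ∀ x y → ⟦ x ⟧ˢ ≈ ⟦ y ⟧ˢ → x ≡ y
  ⟦⟧ˢ-injective Sign.+ Sign.+ _ = ≡.refl
  ⟦⟧ˢ-injective Sign.+ Sign.- e = contradiction e 1≉-1
  ⟦⟧ˢ-injective Sign.- Sign.+ e = contradiction (sym e) 1≉-1
  ⟦⟧ˢ-injective Sign.- Sign.- _ = ≡.refl

  -- The first row of `outer t` is `t` multiplied by its own first sign. Equal first rows therefore
  -- make the vectors equal or opposite, according to whether their first signs agree.
  outer-injective : ∀ {n} (t u : SignVector n) → outer t ≋ outer u → t ≡ u ⊎ t ≡ negate u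
  outer-injective []      []      _   = inj₁ ≡.refl
  outer-injective (x ∷ t) (y ∷ u) t≋u = compare-heads x y products
    where
    products : ∀ i → x Sign.* lookup (x ∷ t) i ≡ y Sign.* lookup (y ∷ u) i
    products i = ⟦⟧ˢ-injective _ _ (trans (sym (⟦⟧ˢ-* x _)) (trans (t≋u (zero , i)) (⟦⟧ˢ-* y _)))

    agree : ∀ {n} (t u : SignVector n) → (∀ i → lookup t i ≡ lookup u i) → t ≡ u
    agree []      []      _ = ≡.refl
    agree (x ∷ t) (y ∷ u) e = ≡.cong₂ _∷_ (e zero) (agree t u (e ∘ suc))

    opposed : ∀ {n} (t u : SignVector n) → (∀ i → lookup t i ≡ Sign.opposite (lookup u i)) → t ≡ negate u
    opposed []      []      _ = ≡.refl
    opposed (x ∷ t) (y ∷ u) e = ≡.cong₂ _∷_ (e zero) (opposed t u (e ∘ suc))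

    opposite-swap : ∀ x y → Sign.opposite x ≡ y → x ≡ Sign.opposite y
    opposite-swap Sign.+ Sign.- _ = ≡.refl
    opposite-swap Sign.- Sign.+ _ = ≡.refl

    opposite-injective : ∀ x y → Sign.opposite x ≡ Sign.opposite y → x ≡ y
    opposite-injective Sign.+ Sign.+ _ = ≡.refl
    opposite-injective Sign.- Sign.- _ = ≡.refl

    compare-heads : ∀ x y → (∀ i → x Sign.* lookup (x ∷ t) i ≡ y Sign.* lookup (y ∷ u) i) →
      x ∷ t ≡ y ∷ u ⊎ x ∷ t ≡ negate (y ∷ u)
    compare-heads Sign.+ Sign.+ e = inj₁ (≡.cong (Sign.+ ∷_) (agree t u (e ∘ suc)))
    compare-heads Sign.- Sign.- e = inj₁ (≡.cong (Sign.- ∷_)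
      (agree t u (λ i → opposite-injective _ _ (e (suc i)))))
    compare-heads Sign.+ Sign.- e = inj₂ (≡.cong (Sign.+ ∷_) (opposed t u (e ∘ suc)))
    compare-heads Sign.- Sign.+ e = inj₂ (≡.cong (Sign.- ∷_)
      (opposed t u (λ i → opposite-swap _ _ (e (suc i)))))

  -- Half the weight of one term is split off as the first of two points of which
  -- the given point is a proper mixture.
  face-summand : ∀ {n r m} {s : Fin r → SignVector n} → IsFace (Elliptope n) (cutHull s) →
    ∀ {A} {c : Fin m → Carrier} {X : Fin m → Matrix n} → A ∈ cutHull s →
    (∀ i → 0# < c i) → sum c ≈ 1# → (∀ i → X i ∈ Elliptope n) → A ≋ combination c X →
    ∀ i → X i ∈ cutHull s
  face-summand {s = s} face {A} {c} {X} A∈F 0<c Σc≈1 X∈E A≋cX i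
    with positive-inverse 0<2
  ... | h , 0<h , 2h≈1 = split (positive-inverse 0<1-τ)
    where
    τ = c i * h

    0<τ : 0# < τ
    0<τ = *-pos (0<c i) 0<h

    0<1-τ : 0# < 1# - τ
    0<1-τ = <-respʳ
      (trans (solve 2 (λ c h → h :+ h :* (:1 :- c) := (:1 :+ :1) :* h :- c :* h) refl (c i) h)
        (+-congʳ 2h≈1))
      (+-pos 0<h (*-nonneg (<⇒≤ 0<h)
        (≤⇒0≤- (≤-respʳ Σc≈1 (term≤sum (λ j → <⇒≤ (0<c j)) i)))))

    split : (∃ λ v → 0# < v × (1# - τ) * v ≈ 1#) → X i ∈ cutHull s
    split (v , 0<v , [1-τ]v≈1) = proj₁ (IsFace.extreme face (X i) (combination d X) τ (X∈E i)
      (elliptope-combination 0≤d Σd≈1 X∈E) 0<τ (0<-⇒< 0<1-τ)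
      (hull-resp (range (λ i → outer (s i))) A≋mix A∈F))
      where
      d : Fin _ → Carrier
      d j = v * c j + - (v * τ) * δ i j

      0≤d : ∀ j → 0# ≤ d j
      0≤d j with i Fin.≟ j
      ... | yes ≡.refl = ≤-respʳ (begin
        v * (c i * h)
          ≈⟨ solve 3 (λ v c h → v :* (c :* h) := v :* c :* ((:1 :+ :1) :* h) :- v :* (c :* h)) refl v (c i) h ⟩
        v * c i * ((1# + 1#) * h) - v * (c i * h)
          ≈⟨ +-cong (*-congˡ 2h≈1) refl ⟩
        v * c i * 1# - v * (c i * h)
          ≈⟨ solve 3 (λ v c h → v :* c :* :1 :- v :* (c :* h) := v :* c :+ (:- (v :* (c :* h))) :* :1) refl v (c i) h ⟩
        v * c i + - (v * τ) * 1#
          ≈⟨ +-congˡ (*-congˡ (δ-refl i)) ⟨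
        d i ∎) (*-nonneg (<⇒≤ 0<v) (<⇒≤ 0<τ))
      ... | no  i≢j    = ≤-respʳ
        (trans (solve 2 (λ x y → x := x :+ y :* :0) refl (v * c j) (- (v * τ))) (+-congˡ (*-congˡ (sym (δ-≢ i≢j)))))
        (*-nonneg (<⇒≤ 0<v) (<⇒≤ (0<c j)))

      Σd≈1 : sum d ≈ 1#
      Σd≈1 = begin
        sum d
          ≈⟨ sum-lin v (- (v * τ)) c (δ i) ⟩
        v * sum c + - (v * τ) * sum (δ i)
          ≈⟨ +-cong (*-congˡ Σc≈1) (*-congˡ (sum-δ-1 i)) ⟩
        v * 1# + - (v * τ) * 1#
          ≈⟨ solve 2 (λ v τ → v :* :1 :+ (:- (v :* τ)) :* :1 := (:1 :- τ) :* v) refl v τ ⟩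
        (1# - τ) * v
          ≈⟨ [1-τ]v≈1 ⟩
        1# ∎

      A≋mix : A ≋ mix τ (X i) (combination d X)
      A≋mix e = begin
        A e
          ≈⟨ A≋cX e ⟩
        combination c X e
          ≈⟨ solve 3 (λ x y τ → x := τ :* y :+ :1 :* (x :- τ :* y)) refl (combination c X e) (X i e) τ ⟩
        τ * X i e + 1# * (combination c X e - τ * X i e)
          ≈⟨ +-congˡ (*-congʳ [1-τ]v≈1) ⟨
        τ * X i e + (1# - τ) * v * (combination c X e - τ * X i e)
          ≈⟨ +-congˡ (solve 4 (λ τ v x y → (:1 :- τ) :* v :* (x :- τ :* y) :=
               (:1 :- τ) :* (v :* x :+ (:- (v :* τ)) :* y)) refl τ v (combination c X e) (X i e)) ⟩
        τ * X i e + (1# - τ) * (v * combination c X e + - (v * τ) * X i e)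
          ≈⟨ +-congˡ (*-congˡ (+-congˡ (*-congˡ (combination-δ i X e)))) ⟨
        τ * X i e + (1# - τ) * (v * combination c X e + - (v * τ) * combination (δ i) X e)
          ≈⟨ +-congˡ (*-congˡ (combination-lin v (- (v * τ)) c (δ i) X e)) ⟨
        mix τ (X i) (combination d X) e ∎

  -- Decompositions are not compared with each other directly: each is matched bijectively with the
  -- vertices and their fixed weights, and two such matchings compose to the required permutation.
  record VertexIndexing {n k} (p : Fin k → Matrix n) (c : Fin k → Carrier)
                        {A : Matrix n} (D : SignDecomposition A) : Set where
    field
      index      : Fin (terms D) → Fin k
      injective  : ∀ {i j} → index i ≡ index j → i ≡ j
      surjective : ∀ j → ∃ λ i → index i ≡ j
      weight≈    : ∀ i → weight D i ≈ c (index i)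
      outer≋     : ∀ i → outer (vector D i) ≋ p (index i)

  sameDecomposition : ∀ {n k} {p : Fin k → Matrix n} {c A} {D E : SignDecomposition A} →
    VertexIndexing p c D → VertexIndexing p c E → SameDecomposition D E
  sameDecomposition {p = p} {c} {D = D} {E} V W = Permutation.↔⇒≡ π , π , λ i →
    trans (V.weight≈ i) (trans (reflexive (≡.cong c (≡.sym (matched i)))) (sym (W.weight≈ (to i)))) ,
    outer-injective (vector D i) (vector E (to i)) (λ a → trans (V.outer≋ i a)
      (trans (reflexive (≡.cong (λ l → p l a) (≡.sym (matched i)))) (sym (W.outer≋ (to i) a))))
    where
    module V = VertexIndexing V
    module W = VertexIndexing W

    to : Fin (terms D) → Fin (terms E)
    to i = proj₁ (W.surjective (V.index i))

    from : Fin (terms E) → Fin (terms D)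
    from j = proj₁ (V.surjective (W.index j))

    matched : ∀ i → W.index (to i) ≡ V.index i
    matched i = proj₂ (W.surjective (V.index i))

    matched⁻¹ : ∀ j → V.index (from j) ≡ W.index j
    matched⁻¹ j = proj₂ (V.surjective (W.index j))

    π : Permutation (terms D) (terms E)
    π = permutation to from
      (λ j → W.injective (≡.trans (matched (from j)) (matched⁻¹ j)))
      (λ i → V.injective (≡.trans (matched⁻¹ (to i)) (matched i)))

  module _ {n r} (s : Fin r → SignVector n) (face : IsFace (Elliptope n) (cutHull s))
           {k} (p : Fin k → Matrix n) (p-independent : AffinelyIndependent p)
           (F≐simplex : cutHull s ≐ conv (range p)) where

    vertex∈elliptope : ∀ j → p j ∈ Elliptope n
    vertex∈elliptope j = cutHull⊆elliptope s (proj₂ F≐simplex (vertex∈hull p j))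

    -- A sign matrix is extreme in the elliptope, so a vertex with nonzero weight in its barycentric
    -- representation has to equal it.
    outer-vertex : ∀ t → outer t ∈ cutHull s → ∃ λ j → outer t ≋ p j
    outer-vertex t t∈F with hull-coefficients (proj₁ F≐simplex t∈F)
    ... | c , 0≤c , Σc≈1 , t≋cp = some-extreme t 0≤c Σc≈1 vertex∈elliptope t≋cp

    sign-vertex : ∀ i → ∃ λ j → outer (s i) ≋ p j
    sign-vertex i = outer-vertex (s i) (vertex∈hull (λ i → outer (s i)) i)

    vertex-injective : ∀ {i j} → p i ≋ p j → i ≡ j
    vertex-injective {i} {j} pi≋pj = decidable-stable (i Fin.≟ j) λ i≢j → 1≉0 (begin
      1#     ≈⟨ δ-refl i ⟨
      δ i i  ≈⟨ coefficients-unique p-independent (δ i) (δ j)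
                  (trans (sum-δ-1 i) (sym (sum-δ-1 j)))
                  (λ a → trans (combination-δ i p a) (trans (pi≋pj a) (sym (combination-δ j p a)))) i ⟩
      δ j i  ≈⟨ δ-≢ (i≢j ∘ ≡.sym) ⟩
      0#     ∎)

    -- Nothing says in advance that a vertex of the simplex is a sign matrix. It is a mixture of the
    -- `outer (s i)`, each of which is some vertex; uniqueness of barycentric coordinates forces one
    -- of these to be the vertex in question.
    vertex-sign : ∀ j → ∃ λ i → p j ≋ outer (s i)
    vertex-sign j = proj₁ preimage , λ a → trans
      (reflexive (≡.cong (λ l → p l a) (≡.sym (proj₂ preimage))))
      (sym (proj₂ (sign-vertex (proj₁ preimage)) a))
      where
      ρ : Fin r → Fin k
      ρ i = proj₁ (sign-vertex i)

      preimage-of : (∃ λ d → (∀ i → 0# ≤ d i) × sum d ≈ 1# × p j ≋ combination d (λ i → outer (s i))) →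
        ∃ λ i → ρ i ≡ j
      preimage-of (d , _ , Σd≈1 , pj≋) = pushforward-support ρ d j (λ push≈0 → 1≉0 (begin
        1#                 ≈⟨ δ-refl j ⟨
        δ j j              ≈⟨ coefficients-unique p-independent (δ j) (pushforward ρ d)
          (trans (sum-δ-1 j) (sym (trans (sum-pushforward-1 ρ d) Σd≈1)))
          (λ a → trans (combination-δ j p a) (trans (pj≋ a) (trans
            (combination-congʳ d (proj₂ ∘ sign-vertex) a) (sym (combination-pushforward ρ d p a))))) j ⟩
        pushforward ρ d j  ≈⟨ push≈0 ⟩
        0#                 ∎))

      preimage : ∃ λ i → ρ i ≡ j
      preimage = preimage-of (hull-coefficients (proj₂ F≐simplex (vertex∈hull p j)))

    -- Distinct sign matrices are distinct vertices, so pushing an affine relation forward to the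
    -- vertices merges no coefficients.
    outers-affinelyIndependent : (∀ i j → outer (s i) ≋ outer (s j) → i ≡ j) →
      AffinelyIndependent (λ i → outer (s i))
    outers-affinelyIndependent outers-injective c Σc≈0 cO≈0 i = begin
      c i                    ≈⟨ pushforward-injective ρ c ρ-injective i ⟨
      pushforward ρ c (ρ i)  ≈⟨ p-independent (pushforward ρ c)
        (trans (sum-pushforward-1 ρ c) Σc≈0)
        (λ a → trans (combination-pushforward ρ c p a) (trans
          (combination-congʳ c (λ i a → sym (proj₂ (sign-vertex i) a)) a) (cO≈0 a))) (ρ i) ⟩
      0#                     ∎
      where
      ρ : Fin r → Fin k
      ρ i = proj₁ (sign-vertex i)

      ρ-injective : ∀ {i j} → ρ i ≡ ρ j → i ≡ j
      ρ-injective {i} {j} e = outers-injective i j (λ a → trans (proj₂ (sign-vertex i) a)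
        (trans (reflexive (≡.cong (λ l → p l a) e)) (sym (proj₂ (sign-vertex j) a))))

    module _ {A} (A∈F : A ∈ cutHull s) {coordinate : Fin k → Carrier}
             (Σcoordinate : sum coordinate ≈ 1#) (A≋coordinates : A ≋ combination coordinate p) where

      -- Moving A slightly away from a vertex stays in the face, so that vertex
      -- cannot have weight zero.
      module Positivity (0≤coordinate : ∀ j → 0# ≤ coordinate j)
        {ε} (0<ε : 0# < ε) (ball : ∀ y → y ∈ aff (cutHull s) → dist² A y < ε * ε → y ∈ cutHull s)
        (j : Fin k) {m} (0<m : 0# < m) ([1+D]m≈1 : (1# + dist² A (p j)) * m ≈ 1#) where

        D = dist² A (p j)

        0≤D : 0# ≤ D
        0≤D = sum-nonneg (λ a → sum-nonneg (λ b → square-nonneg (A (a , b) - p j (a , b))))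

        -- Chosen so that no square root is needed: `m` is the inverse of `1 + D`, and
        -- `η²D = ε²D/(1 + D)²` is below `ε²` because `(1 + D)²` exceeds `D` by `1 + D + D²`.
        η = ε * m

        y : Matrix n
        y e = (1# + η) * A e + - η * p j e

        y∈aff : y ∈ aff (cutHull s)
        y∈aff = 2 , A ◂ p j ◂ (λ ()) , (1# + η) ◂ - η ◂ (λ ()) ,
          (λ { zero → A∈F ; (suc zero) → proj₂ F≐simplex (vertex∈hull p j) }) ,
          solve 1 (λ η → (:1 :+ η) :+ ((:- η) :+ :0) := :1) refl η ,
          (λ e → +-congˡ (sym (+-identityʳ _)))

        distance : dist² A y ≈ η * η * D
        distance = begin
          dist² A y
            ≈⟨ sum-cong (λ a → sum-cong (λ b → solve 3 (λ x q η →
                 (x :- ((:1 :+ η) :* x :+ (:- η) :* q)) :* (x :- ((:1 :+ η) :* x :+ (:- η) :* q)) :=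
                 η :* η :* ((x :- q) :* (x :- q))) refl (A (a , b)) (p j (a , b)) η)) ⟩
          ∑[ a < n ] ∑[ b < n ] (η * η * ((A (a , b) - p j (a , b)) * (A (a , b) - p j (a , b))))
            ≈⟨ sum-cong (λ a → *-distribˡ-sum (η * η)
                 (λ b → (A (a , b) - p j (a , b)) * (A (a , b) - p j (a , b)))) ⟨
          ∑[ a < n ] (η * η * ∑[ b < n ] ((A (a , b) - p j (a , b)) * (A (a , b) - p j (a , b))))
            ≈⟨ *-distribˡ-sum (η * η)
                 (λ a → ∑[ b < n ] ((A (a , b) - p j (a , b)) * (A (a , b) - p j (a , b)))) ⟨
          η * η * D ∎

        close : dist² A y < ε * ε
        close = <-respˡ (sym distance) (0<-⇒< (<-respʳ gap
          (*-pos (*-pos (*-pos 0<ε 0<m) (*-pos 0<ε 0<m)) (+-pos (+-pos 0<1 0≤D) (*-nonneg 0≤D 0≤D)))))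
          where
          gap : η * η * (1# + D + D * D) ≈ ε * ε - η * η * D
          gap = begin
            ε * m * (ε * m) * (1# + D + D * D)
              ≈⟨ solve 3 (λ ε m D → ε :* m :* (ε :* m) :* (:1 :+ D :+ D :* D) :=
                   ε :* ε :* ((:1 :+ D) :* m :* ((:1 :+ D) :* m)) :- ε :* m :* (ε :* m) :* D) refl ε m D ⟩
            ε * ε * ((1# + D) * m * ((1# + D) * m)) - η * η * D
              ≈⟨ +-congʳ (trans (*-congˡ (trans (*-cong [1+D]m≈1 [1+D]m≈1) (*-identityˡ 1#))) (*-identityʳ _)) ⟩
            ε * ε - η * η * D ∎

        y-coordinate : ∀ d → sum d ≈ 1# → y ≋ combination d p →
          d j ≈ (1# + η) * coordinate j + - η * δ j j
        y-coordinate d Σd≈1 y≋dp = coefficients-unique p-independent d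
          (λ i → (1# + η) * coordinate i + - η * δ j i)
          (begin
            sum d  ≈⟨ Σd≈1 ⟩
            1#     ≈⟨ solve 1 (λ η → :1 := (:1 :+ η) :* :1 :+ (:- η) :* :1) refl η ⟩
            (1# + η) * 1# + - η * 1#  ≈⟨ +-cong (*-congˡ Σcoordinate) (*-congˡ (sum-δ-1 j)) ⟨
            (1# + η) * sum coordinate + - η * sum (δ j)  ≈⟨ sum-lin (1# + η) (- η) coordinate (δ j) ⟨
            _ ∎)
          (λ e → begin
            combination d p e  ≈⟨ y≋dp e ⟨
            (1# + η) * A e + - η * p j e
              ≈⟨ +-cong (*-congˡ (A≋coordinates e)) (*-congˡ (sym (combination-δ j p e))) ⟩
            (1# + η) * combination coordinate p e + - η * combination (δ j) p e
              ≈⟨ combination-lin (1# + η) (- η) coordinate (δ j) p e ⟨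
            _ ∎) j

        -- Uniqueness of barycentric coordinates would give `y` the coordinate minus `η` at `j`.
        contradictory : coordinate j ≈ 0# →
          ¬ (∃ λ d → (∀ i → 0# ≤ d i) × sum d ≈ 1# × y ≋ combination d p)
        contradictory cj≈0 (d , 0≤d , Σd≈1 , y≋dp) = <⇒≱ (*-pos 0<ε 0<m) (0≤-⇒≤ (≤-respʳ (begin
          d j
            ≈⟨ y-coordinate d Σd≈1 y≋dp ⟩
          (1# + η) * coordinate j + - η * δ j j
            ≈⟨ +-cong (*-congˡ cj≈0) (*-congˡ (δ-refl j)) ⟩
          (1# + η) * 0# + - η * 1#
            ≈⟨ solve 1 (λ η → (:1 :+ η) :* :0 :+ (:- η) :* :1 := :0 :- η) refl η ⟩
          0# - η ∎) (0≤d j)))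

        positive-coordinate : 0# < coordinate j
        positive-coordinate = 0≤⇒≉⇒0< (0≤coordinate j) (λ cj≈0 →
          contradictory cj≈0 (hull-coefficients (proj₁ F≐simplex (ball y y∈aff close))))

    relint⇒positive : ∀ {A} → A ∈ relint (cutHull s) →
      ∃ λ c → (∀ j → 0# < c j) × sum c ≈ 1# × A ≋ combination c p
    relint⇒positive {A} (A∈F , ε , 0<ε , ball) = extract (hull-coefficients (proj₁ F≐simplex A∈F))
      where
      extract : (∃ λ c → (∀ i → 0# ≤ c i) × sum c ≈ 1# × A ≋ combination c p) →
        ∃ λ c → (∀ j → 0# < c j) × sum c ≈ 1# × A ≋ combination c p
      extract (c , 0≤c , Σc≈1 , A≋cp) = c , positive-at , Σc≈1 , A≋cp
        where
        positive-at : ∀ j → 0# < c j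
        positive-at j = conclude (positive-inverse (+-pos 0<1
          (sum-nonneg (λ a → sum-nonneg (λ b → square-nonneg (A (a , b) - p j (a , b)))))))
          where
          conclude : (∃ λ m → 0# < m × (1# + dist² A (p j)) * m ≈ 1#) → 0# < c j
          conclude (m , 0<m , [1+D]m≈1) =
            Positivity.positive-coordinate {A} A∈F Σc≈1 A≋cp 0≤c 0<ε ball j 0<m [1+D]m≈1

    module _ {A} (A∈F : A ∈ cutHull s) {coordinate : Fin k → Carrier}
             (coordinate-positive : ∀ j → 0# < coordinate j)
             (Σcoordinate : sum coordinate ≈ 1#) (A≋coordinates : A ≋ combination coordinate p) where

      vertexDecomposition : SignDecomposition A
      vertexDecomposition = record
        { terms    = k
        ; weight   = coordinate
        ; vector   = λ j → s (proj₁ (vertex-sign j))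
        ; positive = coordinate-positive
        ; total    = Σcoordinate
        ; distinct = λ i j i≢j e → i≢j (vertex-injective (λ a →
            trans (proj₂ (vertex-sign i) a) (trans (e a) (sym (proj₂ (vertex-sign j) a)))))
        ; equation = λ a → trans (A≋coordinates a)
            (combination-congʳ coordinate (proj₂ ∘ vertex-sign) a)
        }

      module _ (D : SignDecomposition A) where

        term-vertex : ∀ i → ∃ λ j → outer (vector D i) ≋ p j
        term-vertex i = outer-vertex (vector D i) (face-summand {s = s} face A∈F (positive D) (total D)
          (λ i → outer∈elliptope (vector D i)) (equation D) i)

        vertexIndex : Fin (terms D) → Fin k
        vertexIndex i = proj₁ (term-vertex i)

        vertexIndex-injective : ∀ {i j} → vertexIndex i ≡ vertexIndex j → i ≡ j
        vertexIndex-injective {i} {j} e = decidable-stable (i Fin.≟ j) (λ i≢j → distinct D i j i≢j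
          (λ a → trans (proj₂ (term-vertex i) a)
            (trans (reflexive (≡.cong (λ l → p l a) e)) (sym (proj₂ (term-vertex j) a)))))

        pushforward-weight : ∀ j → pushforward vertexIndex (weight D) j ≈ coordinate j
        pushforward-weight = coefficients-unique p-independent (pushforward vertexIndex (weight D)) coordinate
          (trans (sum-pushforward-1 vertexIndex (weight D)) (trans (total D) (sym Σcoordinate)))
          (λ a → trans (combination-pushforward vertexIndex (weight D) p a) (trans
            (combination-congʳ (weight D) (λ i a → sym (proj₂ (term-vertex i) a)) a)
            (trans (sym (equation D a)) (A≋coordinates a))))

        weight≈coordinate : ∀ i → weight D i ≈ coordinate (vertexIndex i)
        weight≈coordinate i = trans
          (sym (pushforward-injective vertexIndex (weight D) vertexIndex-injective i))
          (pushforward-weight (vertexIndex i))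

        -- A vertex missed by every term would receive total weight zero, against the positivity of
        -- its coordinate.
        vertexIndex-surjective : ∀ j → ∃ λ i → vertexIndex i ≡ j
        vertexIndex-surjective j = pushforward-support vertexIndex (weight D) j
          (λ push≈0 → <⇒≉ (coordinate-positive j) (trans (sym push≈0) (pushforward-weight j)))

        vertexIndexing : VertexIndexing p coordinate D
        vertexIndexing = record
          { index      = vertexIndex
          ; injective  = vertexIndex-injective
          ; surjective = vertexIndex-surjective
          ; weight≈    = weight≈coordinate
          ; outer≋     = λ i → proj₂ (term-vertex i)
          }

  relint-unique : ∀ {n r} (s : Fin r → SignVector n) → IsSimplicialFace (Elliptope n) (cutHull s) →
    ∀ A → A ∈ relint (cutHull s) → HasUniqueSignDecomposition A
  relint-unique s (face , k , p , p-independent , F≐) A A∈relint =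
    conclude (relint⇒positive s face p p-independent F≐ A∈relint)
    where
    conclude : (∃ λ c → (∀ j → 0# < c j) × sum c ≈ 1# × A ≋ combination c p) →
      HasUniqueSignDecomposition A
    conclude (c , 0<c , Σc≈1 , A≋cp) =
      vertexDecomposition s face p p-independent F≐ (proj₁ A∈relint) 0<c Σc≈1 A≋cp ,
      λ D E → sameDecomposition (indexing D) (indexing E)
      where
      indexing : ∀ D → VertexIndexing p c D
      indexing = vertexIndexing s face p p-independent F≐ (proj₁ A∈relint) 0<c Σc≈1 A≋cp

-- From a simplicial face to Schur independence.

module FacesSchur (ℝ : RealNumbers) where

  open RealNumbers ℝ hiding (zero)
  open OrderedField ℝ
  open Geometry ℝ
  open FiniteSums ℝ
  open LinearAlgebra ℝ
  open Elliptopes ℝ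
  open SchurProducts ℝ
  open SchurFaces ℝ
  open SimplicialFaces ℝ
  open SetoidReasoning setoid

  bilinear-outers : ∀ {n r} (c : Fin r → Carrier) (s : Fin r → SignVector n) v →
    bilinear (combination c (λ i → outer (s i))) v v ≈
    ∑[ i < r ] (c i * ((⟦ s i ⟧ · v) * (⟦ s i ⟧ · v)))
  bilinear-outers c s v = trans (bilinear-combination c (λ i → outer (s i)) v v)
    (sum-cong (λ i → *-congˡ {x = c i} (trans (bilinear-rank-one ⟦ s i ⟧ ⟦ s i ⟧ v v)
      (*-congʳ (·-comm v ⟦ s i ⟧)))))

  -- Meant for combinations with a negative coefficient, whose form is nonnegative for reasons other
  -- than the signs of the coefficients.
  outers∈elliptope : ∀ {n r} {c : Fin r → Carrier} (s : Fin r → SignVector n) → sum c ≈ 1# →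
    (∀ v → 0# ≤ ∑[ i < r ] (c i * ((⟦ s i ⟧ · v) * (⟦ s i ⟧ · v)))) →
    combination c (λ i → outer (s i)) ∈ Elliptope n
  outers∈elliptope {c = c} s Σc≈1 0≤form =
    (λ a b → sum-cong (λ i → *-congˡ (*-comm (⟦ s i ⟧ a) (⟦ s i ⟧ b)))) ,
    (λ a → trans (sum-cong (λ i → trans (*-congˡ {x = c i} (⟦⟧ˢ-square (lookup (s i) a))) (*-identityʳ (c i)))) Σc≈1) ,
    (λ v → ≤-respʳ (sym (bilinear-outers c s v)) (0≤form v))

  gram-lin : ∀ {n r} α β (G H : Fin r → Fin r → Carrier) (s : Fin r → SignVector n) e →
    gram (λ i j → α * G i j + β * H i j) s e ≈ α * gram G s e + β * gram H s e
  gram-lin {r = r} α β G H s e@(a , b) = trans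
    (sum-cong (λ i → trans
      (sum-cong (λ j → solve 5 (λ α β g h x → (α :* g :+ β :* h) :* x := α :* (g :* x) :+ β :* (h :* x)) refl
        α β (G i j) (H i j) (⟦ s i ⟧ a * ⟦ s j ⟧ b)))
      (sum-lin α β (λ j → G i j * (⟦ s i ⟧ a * ⟦ s j ⟧ b)) (λ j → H i j * (⟦ s i ⟧ a * ⟦ s j ⟧ b)))))
    (sum-lin α β (λ i → ∑[ j < r ] (G i j * (⟦ s i ⟧ a * ⟦ s j ⟧ b)))
                 (λ i → ∑[ j < r ] (H i j * (⟦ s i ⟧ a * ⟦ s j ⟧ b))))

  gram-symmetric : ∀ {n r} {G : Fin r → Fin r → Carrier} (s : Fin r → SignVector n) →
    (∀ i j → G i j ≈ G j i) → Symmetric (gram G s)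
  gram-symmetric {G = G} s symmetric a b = trans
    (∑-comm (λ i j → G i j * (⟦ s i ⟧ a * ⟦ s j ⟧ b)))
    (sum-cong (λ j → sum-cong (λ i → *-cong (symmetric i j) (*-comm (⟦ s i ⟧ a) (⟦ s j ⟧ b)))))

  gram-δ : ∀ {n r} (s : Fin r → SignVector n) →
    gram δ s ≋ combination (λ _ → 1#) (λ i → outer (s i))
  gram-δ s e = trans (diagonal-gram s (λ i j → δ-≢) e)
    (combination-congˡ (λ i → outer (s i)) δ-refl e)

  module _ {n r} (s : Fin r → SignVector n) (face : IsFace (Elliptope n) (cutHull s))
           (outers-independent : AffinelyIndependent (λ i → outer (s i))) where

    private
      O : Fin r → Matrix n
      O i = outer (s i)

    -- If s k is a combination of the others, its rank-one form is dominated by a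
    -- multiple of theirs, so the weighted mean N of the other vertices can be moved
    -- away from s k within the elliptope.
    module Dependence (k : Fin r) (a : Fin n) {c : Fin r → Carrier}
                      (cs≈0 : combination c (signs s) ≋ 𝟘) (ck≉0 : ¬ (c k ≈ 0#)) where

      -- Deletes the index `k` by giving it weight zero, so that sums over the other indices still
      -- run over all of `Fin r`.
      mask : Fin r → Carrier
      mask i = 1# - δ k i

      mask-self : mask k ≈ 0#
      mask-self = x≈y⇒x-y≈0 (sym (δ-refl k))

      module _ {v} (ck·v≈1 : c k * v ≈ 1#) where

        b : Fin r → Carrier
        b i = - (v * c i)

        component : ∀ x → ⟦ s k ⟧ · x ≈ ∑[ i < r ] (b i * (mask i * (⟦ s i ⟧ · x)))
        component x = sym (begin
          ∑[ i < r ] (b i * (mask i * y i))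
            ≈⟨ sum-cong (λ i → solve 4 (λ v c d y → (:- (v :* c)) :* ((:1 :- d) :* y) :=
                 v :* (d :* (c :* y)) :+ (:- v) :* (c :* y)) refl v (c i) (δ k i) (y i)) ⟩
          ∑[ i < r ] (v * (δ k i * (c i * y i)) + - v * (c i * y i))
            ≈⟨ sum-lin v (- v) (λ i → δ k i * (c i * y i)) (λ i → c i * y i) ⟩
          v * ∑[ i < r ] (δ k i * (c i * y i)) + - v * ∑[ i < r ] (c i * y i)
            ≈⟨ +-cong (*-congˡ (sum-δ k (λ i → c i * y i))) (*-congˡ Σcy≈0) ⟩
          v * (c k * y k) + - v * 0#
            ≈⟨ solve 3 (λ v c y → v :* (c :* y) :+ (:- v) :* :0 := c :* v :* y) refl v (c k) (y k) ⟩
          c k * v * y k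
            ≈⟨ trans (*-congʳ ck·v≈1) (*-identityˡ _) ⟩
          y k ∎)
          where
          y : Fin r → Carrier
          y i = ⟦ s i ⟧ · x

          Σcy≈0 : ∑[ i < r ] (c i * y i) ≈ 0#
          Σcy≈0 = begin
            ∑[ i < r ] (c i * y i)
              ≈⟨ sum-cong (λ i → *-congˡ {x = c i} (·-comm ⟦ s i ⟧ x)) ⟩
            ∑[ i < r ] (c i * (x · ⟦ s i ⟧))
              ≈⟨ ·-combination x c (signs s) ⟨
            x · combination c (signs s)
              ≈⟨ sum-0 (λ a → trans (*-congˡ (cs≈0 a)) (zeroʳ (x a))) ⟩
            0# ∎

        weight : Fin r → Carrier
        weight i = mask i * mask i

        masked : Space (Fin n) → Carrier
        masked x = ∑[ i < r ] (weight i * ((⟦ s i ⟧ · x) * (⟦ s i ⟧ · x)))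

        -- A Cauchy-Schwarz inequality: `s k · x` is the combination with coefficients `b` of the
        -- other products `s i · x`, so minus its square is a quadratic form in them, bounded below
        -- by minus `K` times the sum of their squares.
        dominated-by : ∀ {K} → (∀ y → 0# ≤ K * (y · y) + ∑[ i < r ] ∑[ j < r ] (- (b i * b j) * (y i * y j))) →
          ∀ x → 0# ≤ K * masked x - (⟦ s k ⟧ · x) * (⟦ s k ⟧ · x)
        dominated-by {K} bound x = ≤-respʳ (+-cong (*-congˡ y·y) (trans square (-‿cong
          (sym (*-cong (component x) (component x)))))) (bound y)
          where
          y : Fin r → Carrier
          y i = mask i * (⟦ s i ⟧ · x)

          y·y : y · y ≈ masked x
          y·y = sum-cong (λ i → solve 2 (λ m z → m :* z :* (m :* z) := m :* m :* (z :* z)) refl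
            (mask i) (⟦ s i ⟧ · x))

          T = ∑[ i < r ] (b i * y i)

          square : ∑[ i < r ] ∑[ j < r ] (- (b i * b j) * (y i * y j)) ≈ - (T * T)
          square = begin
            ∑[ i < r ] ∑[ j < r ] (- (b i * b j) * (y i * y j))
              ≈⟨ sum-cong (λ i → trans
                   (sum-cong (λ j → solve 4 (λ b d y z → (:- (b :* d)) :* (y :* z) := (:- (b :* y)) :* (d :* z)) refl
                     (b i) (b j) (y i) (y j)))
                   (sym (*-distribˡ-sum (- (b i * y i)) (λ j → b j * y j)))) ⟩
            ∑[ i < r ] (- (b i * y i) * T)
              ≈⟨ sum-cong (λ i → solve 2 (λ x t → (:- x) :* t := (:- t) :* x) refl (b i * y i) T) ⟩
            ∑[ i < r ] (- T * (b i * y i))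
              ≈⟨ *-distribˡ-sum (- T) (λ i → b i * y i) ⟨
            - T * T
              ≈⟨ solve 1 (λ t → (:- t) :* t := :- (t :* t)) refl T ⟩
            - (T * T) ∎

        module _ {K} (0<K : 0# < K)
                 (dominated : ∀ x → 0# ≤ K * masked x - (⟦ s k ⟧ · x) * (⟦ s k ⟧ · x)) where

          0≤weight : ∀ i → 0# ≤ weight i
          0≤weight i = square-nonneg (mask i)

          μ = sum weight

          square-δ : ∀ i → (⟦ s i ⟧ · δ a) * (⟦ s i ⟧ · δ a) ≈ 1#
          square-δ i = trans (*-cong value value) (⟦⟧ˢ-square (lookup (s i) a))
            where
            value : ⟦ s i ⟧ · δ a ≈ ⟦ s i ⟧ a
            value = trans (·-comm ⟦ s i ⟧ (δ a)) (sum-δ a ⟦ s i ⟧)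

          -- Some other sign vector must remain: at the basis vector of `a` all squares are 1, and
          -- domination with total weight zero would read `0 ≤ -1`.
          0<μ : 0# < μ
          0<μ = 0≤⇒≉⇒0< (sum-nonneg 0≤weight) (λ μ≈0 → <⇒≱ 0<1 (0≤-⇒≤ (≤-respʳ (+-cong
            (trans (*-congˡ (trans (sum-cong (λ i → trans (*-congˡ {x = weight i} (square-δ i)) (*-identityʳ _))) μ≈0))
              (zeroʳ K))
            (-‿cong (square-δ k))) (dominated (δ a)))))

          module _ {ν L} (0<ν : 0# < ν) (μν≈1 : μ * ν ≈ 1#) (0<L : 0# < L) (KL≈1 : K * L ≈ 1#) where

            -- Chosen so that `κ * K` is `ν`. Then `κ` times the domination inequality says that the
            -- form of `N` is at least `κ` times that of `outer (s k)`, which keeps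
            -- `(1 + κ) N - κ outer (s k)` positive semidefinite.
            κ = ν * L

            0<κ : 0# < κ
            0<κ = *-pos 0<ν 0<L

            0<1+κ : 0# < 1# + κ
            0<1+κ = +-pos 0<1 (<⇒≤ 0<κ)

            N : Matrix n
            N = combination (λ i → ν * weight i) O

            N∈F : N ∈ cutHull s
            N∈F = in-hull (λ i → ν * weight i) (λ i → *-nonneg (<⇒≤ 0<ν) (0≤weight i))
              (trans (sym (*-distribˡ-sum ν weight)) (trans (*-comm ν μ) μν≈1)) (λ _ → refl)

            z : Fin r → Carrier
            z i = (1# + κ) * ν * weight i + - κ * δ k i

            Σz≈1 : sum z ≈ 1#
            Σz≈1 = begin
              sum z
                ≈⟨ sum-lin ((1# + κ) * ν) (- κ) weight (δ k) ⟩
              (1# + κ) * ν * μ + - κ * sum (δ k)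
                ≈⟨ +-congˡ (*-congˡ (sum-δ-1 k)) ⟩
              (1# + κ) * ν * μ + - κ * 1#
                ≈⟨ solve 3 (λ κ ν μ → (:1 :+ κ) :* ν :* μ :+ (:- κ) :* :1 :=
                     (:1 :+ κ) :* (μ :* ν) :- κ) refl κ ν μ ⟩
              (1# + κ) * (μ * ν) - κ
                ≈⟨ +-congʳ (*-congˡ μν≈1) ⟩
              (1# + κ) * 1# - κ
                ≈⟨ solve 1 (λ κ → (:1 :+ κ) :* :1 :- κ := :1) refl κ ⟩
              1# ∎

            0≤z-form : ∀ x → 0# ≤ ∑[ i < r ] (z i * ((⟦ s i ⟧ · x) * (⟦ s i ⟧ · x)))
            0≤z-form x = ≤-respʳ (begin
              κ * ν * masked x + κ * (K * masked x - q k)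
                ≈⟨ solve 6 (λ ν L M K κ q → κ :* ν :* M :+ ν :* L :* (K :* M :- q) :=
                     κ :* ν :* M :+ ν :* (K :* L) :* M :- ν :* L :* q) refl ν L (masked x) K κ (q k) ⟩
              κ * ν * masked x + ν * (K * L) * masked x - κ * q k
                ≈⟨ +-congʳ (+-congˡ (*-congʳ (*-congˡ KL≈1))) ⟩
              κ * ν * masked x + ν * 1# * masked x - κ * q k
                ≈⟨ solve 4 (λ κ ν M q → κ :* ν :* M :+ ν :* :1 :* M :- κ :* q :=
                     (:1 :+ κ) :* ν :* M :+ (:- κ) :* q) refl κ ν (masked x) (q k) ⟩
              (1# + κ) * ν * masked x + - κ * q k
                ≈⟨ +-congˡ (*-congˡ (sum-δ k q)) ⟨
              (1# + κ) * ν * masked x + - κ * ∑[ i < r ] (δ k i * q i)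
                ≈⟨ sum-lin ((1# + κ) * ν) (- κ) (λ i → weight i * q i) (λ i → δ k i * q i) ⟨
              ∑[ i < r ] ((1# + κ) * ν * (weight i * q i) + - κ * (δ k i * q i))
                ≈⟨ sum-cong (λ i → solve 5 (λ α β w d q → α :* (w :* q) :+ β :* (d :* q) :=
                     (α :* w :+ β :* d) :* q) refl ((1# + κ) * ν) (- κ) (weight i) (δ k i) (q i)) ⟩
              ∑[ i < r ] (z i * q i) ∎)
              (+-nonneg (*-nonneg (*-nonneg (<⇒≤ 0<κ) (<⇒≤ 0<ν)) 0≤masked)
                        (*-nonneg (<⇒≤ 0<κ) (dominated x)))
              where
              q : Fin r → Carrier
              q i = (⟦ s i ⟧ · x) * (⟦ s i ⟧ · x)

              0≤masked : 0# ≤ masked x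
              0≤masked = sum-nonneg (λ i → *-nonneg (0≤weight i) (square-nonneg (⟦ s i ⟧ · x)))

            Z : Matrix n
            Z = combination z O

            Z∈E : Z ∈ Elliptope n
            Z∈E = outers∈elliptope s Σz≈1 0≤z-form

            -- `Z` lies beyond `N` as seen from `outer (s k)`: solving for `N` makes it the mixture
            -- of the two in which `Z` has weight `1/(1 + κ)`.
            Z∈F : ∀ {τ} → 0# < τ → (1# + κ) * τ ≈ 1# → Z ∈ cutHull s
            Z∈F {τ} 0<τ [1+κ]τ≈1 = proj₁ (IsFace.extreme face Z (O k) τ Z∈E (outer∈elliptope (s k)) 0<τ τ<1
              (hull-resp (range O) N≋mix N∈F))
              where
              τ<1 : τ < 1#
              τ<1 = 0<-⇒< (<-respʳ (trans (solve 2 (λ κ τ → κ :* τ := (:1 :+ κ) :* τ :- τ) refl κ τ)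
                (+-congʳ [1+κ]τ≈1)) (*-pos 0<κ 0<τ))

              N≋mix : N ≋ mix τ Z (O k)
              N≋mix e = sym (begin
                τ * Z e + (1# - τ) * O k e
                  ≈⟨ +-congʳ (*-congˡ (combination-lin ((1# + κ) * ν) (- κ) weight (δ k) O e)) ⟩
                τ * ((1# + κ) * ν * combination weight O e + - κ * combination (δ k) O e) + (1# - τ) * O k e
                  ≈⟨ +-congʳ (*-congˡ (+-congˡ (*-congˡ (combination-δ k O e)))) ⟩
                τ * ((1# + κ) * ν * combination weight O e + - κ * O k e) + (1# - τ) * O k e
                  ≈⟨ solve 5 (λ τ κ ν w o → τ :* ((:1 :+ κ) :* ν :* w :+ (:- κ) :* o) :+ (:1 :- τ) :* o :=
                       (:1 :+ κ) :* τ :* (ν :* w) :+ (:1 :- (:1 :+ κ) :* τ) :* o) refl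
                       τ κ ν (combination weight O e) (O k e) ⟩
                (1# + κ) * τ * (ν * combination weight O e) + (1# - (1# + κ) * τ) * O k e
                  ≈⟨ +-cong (*-congʳ [1+κ]τ≈1) (*-congʳ (+-congˡ (-‿cong [1+κ]τ≈1))) ⟩
                1# * (ν * combination weight O e) + (1# - 1#) * O k e
                  ≈⟨ solve 2 (λ x o → :1 :* x :+ (:1 :- :1) :* o := x) refl (ν * combination weight O e) (O k e) ⟩
                ν * combination weight O e
                  ≈⟨ *-distribˡ-sum ν (λ i → weight i * O i e) ⟩
                ∑[ i < r ] (ν * (weight i * O i e))
                  ≈⟨ sum-cong (λ i → *-assoc ν (weight i) (O i e)) ⟨
                N e ∎)

            absurd : ¬ (∃ λ d → (∀ i → 0# ≤ d i) × sum d ≈ 1# × Z ≋ combination d O)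
            absurd (d , 0≤d , Σd≈1 , Z≋dO) = <⇒≱ 0<κ (0≤-⇒≤ (≤-respʳ (begin
              d k
                ≈⟨ coefficients-unique outers-independent z d (trans Σz≈1 (sym Σd≈1)) Z≋dO k ⟨
              (1# + κ) * ν * (mask k * mask k) + - κ * δ k k
                ≈⟨ +-cong (*-congˡ (*-congʳ mask-self)) (*-congˡ (δ-refl k)) ⟩
              (1# + κ) * ν * (0# * mask k) + - κ * 1#
                ≈⟨ solve 3 (λ κ ν m → (:1 :+ κ) :* ν :* (:0 :* m) :+ (:- κ) :* :1 := :0 :- κ) refl κ ν (mask k) ⟩
              0# - κ ∎) (0≤d k)))

            no-reciprocal : ¬ (∃ λ τ → 0# < τ × (1# + κ) * τ ≈ 1#)
            no-reciprocal (_ , 0<τ , [1+κ]τ≈1) = absurd (hull-coefficients (Z∈F 0<τ [1+κ]τ≈1))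

          not-dominated : ⊥
          not-dominated = choose-ν (positive-inverse 0<μ)
            where
            choose-L : ∀ {ν} → 0# < ν → μ * ν ≈ 1# → ¬ (∃ λ L → 0# < L × K * L ≈ 1#)
            choose-L 0<ν μν≈1 (L , 0<L , KL≈1) = no-reciprocal 0<ν μν≈1 0<L KL≈1
              (positive-inverse (0<1+κ 0<ν μν≈1 0<L KL≈1))

            choose-ν : ¬ (∃ λ ν → 0# < ν × μ * ν ≈ 1#)
            choose-ν (ν , 0<ν , μν≈1) = choose-L 0<ν μν≈1 (positive-inverse 0<K)

        not-inverse : ⊥
        not-inverse = choose-K (form-bounded-below (λ i j → - (b i * b j)))
          where
          choose-K : ¬ (∃ λ K → 0# < K × (∀ y →
            0# ≤ K * (y · y) + ∑[ i < r ] ∑[ j < r ] (- (b i * b j) * (y i * y j))))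
          choose-K (K , 0<K , bound) = not-dominated 0<K (dominated-by bound)

      impossible : ⊥
      impossible = choose-v (inverse (c k) ck≉0)
        where
        choose-v : ¬ (∃ λ v → c k * v ≈ 1#)
        choose-v (v , cv≈1) = not-inverse cv≈1

    face⇒signs-independent : Fin n → LinearlyIndependent (signs s)
    face⇒signs-independent a c cs≈0 k =
      decidable-stable (c k ≟ 0#) (λ ck≉0 → Dependence.impossible k a cs≈0 ck≉0)

    -- The coefficients of centroid plus `κ` times `S G Sᵗ`: below, `κ K` is `1/r`, so the identity
    -- part yields the centroid of the vertices, and `K` is large enough for `K I + G` to be
    -- positive semidefinite.
    perturbed : Carrier → Carrier → (Fin r → Fin r → Carrier) → Fin r → Fin r → Carrier
    perturbed κ K G i j = κ * K * δ i j + κ * G i j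

    perturbed∈elliptope : ∀ {κ K} {G : Fin r → Fin r → Carrier} → 0# ≤ κ → κ * K * sum {r} (λ _ → 1#) ≈ 1# →
      (∀ i j → G i j ≈ G j i) → (∀ a → gram G s (a , a) ≈ 0#) →
      (∀ y → 0# ≤ K * (y · y) + ∑[ i < r ] ∑[ j < r ] (G i j * (y i * y j))) →
      gram (perturbed κ K G) s ∈ Elliptope n
    perturbed∈elliptope {κ} {K} {G} 0≤κ κKr≈1 symmetric diagonal≈0 bound =
      gram-symmetric s (λ i j → +-cong (*-congˡ (δ-sym i j)) (*-congˡ (symmetric i j))) ,
      (λ a → begin
        gram (perturbed κ K G) s (a , a)
          ≈⟨ gram-lin (κ * K) κ δ G s (a , a) ⟩
        κ * K * gram δ s (a , a) + κ * gram G s (a , a)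
          ≈⟨ +-cong (*-congˡ (trans (gram-δ s (a , a)) (sum-cong (λ i →
               trans (*-identityˡ _) (⟦⟧ˢ-square (lookup (s i) a)))))) (*-congˡ (diagonal≈0 a)) ⟩
        κ * K * sum {r} (λ _ → 1#) + κ * 0#
          ≈⟨ trans (+-cong κKr≈1 (zeroʳ κ)) (+-identityʳ 1#) ⟩
        1# ∎) ,
      (λ v → ≤-respʳ (begin
        κ * (K * (y v · y v) + Q v)
          ≈⟨ solve 4 (λ κ K Y Q → κ :* (K :* Y :+ Q) := κ :* K :* Y :+ κ :* Q) refl κ K (y v · y v) (Q v) ⟩
        κ * K * (y v · y v) + κ * Q v
          ≈⟨ +-cong (*-congˡ (norm v)) (*-congˡ (form v)) ⟨
        κ * K * bilinear (gram δ s) v v + κ * bilinear (gram G s) v v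
          ≈⟨ bilinear-mix (κ * K) κ (gram δ s) (gram G s) v v ⟨
        bilinear (λ e → κ * K * gram δ s e + κ * gram G s e) v v
          ≈⟨ bilinear-cong (gram-lin (κ * K) κ δ G s) v v ⟨
        bilinear (gram (perturbed κ K G) s) v v ∎)
        (*-nonneg 0≤κ (bound (y v))))
      where
      y : Space (Fin n) → Fin r → Carrier
      y v i = ⟦ s i ⟧ · v

      Q : Space (Fin n) → Carrier
      Q v = ∑[ i < r ] ∑[ j < r ] (G i j * (y v i * y v j))

      form : ∀ v → bilinear (gram G s) v v ≈ Q v
      form v = trans (bilinear-gram G s v v)
        (sum-cong (λ i → sum-cong (λ j → *-congˡ {x = G i j} (*-congʳ (·-comm v ⟦ s i ⟧)))))

      norm : ∀ v → bilinear (gram δ s) v v ≈ y v · y v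
      norm v = trans (bilinear-cong (gram-δ s) v v) (trans (bilinear-outers (λ _ → 1#) s v)
        (sum-cong (λ i → *-identityˡ (y v i * y v i))))

    module _ {w} (dual : Dual (signs s) w) {G : Fin r → Fin r → Carrier}
             (symmetric : ∀ i j → G i j ≈ G j i) (diagonal≈0 : ∀ a → gram G s (a , a) ≈ 0#) where

      private
        -- The negative of `G`, spelt as a combination of two terms so that `gram-lin` applies to
        -- it.
        G⁻ : Fin r → Fin r → Carrier
        G⁻ i j = 0# * G i j + - 1# * G i j

      module _ {κ K} (0<κ : 0# < κ) (0<K : 0# < K) (κKr≈1 : κ * K * sum {r} (λ _ → 1#) ≈ 1#)
        (bound⁺ : ∀ y → 0# ≤ K * (y · y) + ∑[ i < r ] ∑[ j < r ] (G i j * (y i * y j)))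
        (bound⁻ : ∀ y → 0# ≤ K * (y · y) + ∑[ i < r ] ∑[ j < r ] (G⁻ i j * (y i * y j))) where

        perturbed∈face : gram (perturbed κ K G) s ∈ cutHull s
        perturbed∈face = halve (positive-inverse 0<2)
          where
          X⁺ = gram (perturbed κ K G) s
          X⁻ = gram (perturbed κ K G⁻) s

          centre : combination (λ _ → κ * K) O ∈ cutHull s
          centre = in-hull (λ _ → κ * K) (λ _ → <⇒≤ (*-pos 0<κ 0<K))
            (trans (sum-cong {r} (λ _ → sym (*-identityʳ (κ * K))))
              (trans (sym (*-distribˡ-sum {r} (κ * K) (λ _ → 1#))) κKr≈1))
            (λ _ → refl)

          X⁻∈E : X⁻ ∈ Elliptope n
          X⁻∈E = perturbed∈elliptope (<⇒≤ 0<κ) κKr≈1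
            (λ i j → +-cong (*-congˡ (symmetric i j)) (*-congˡ (symmetric i j)))
            (λ a → trans (gram-lin 0# (- 1#) G G s (a , a))
              (trans (+-cong (zeroˡ _) (*-congˡ (diagonal≈0 a)))
                (trans (+-congˡ (zeroʳ _)) (+-identityʳ 0#))))
            bound⁻

          centre≋mix : ∀ {h} → (1# + 1#) * h ≈ 1# → combination (λ _ → κ * K) O ≋ mix h X⁺ X⁻
          centre≋mix {h} 2h≈1 e = begin
            combination (λ _ → κ * K) O e
              ≈⟨ sum-cong (λ i → trans (*-congʳ (sym (*-identityʳ (κ * K)))) (*-assoc (κ * K) 1# (O i e))) ⟩
            ∑[ i < r ] (κ * K * (1# * O i e))
              ≈⟨ *-distribˡ-sum (κ * K) (λ i → 1# * O i e) ⟨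
            κ * K * combination (λ _ → 1#) O e
              ≈⟨ *-congˡ (gram-δ s e) ⟨
            κ * K * D
              ≈⟨ solve 3 (λ x κ g → x := x :+ (:1 :- :1) :* κ :* g) refl (κ * K * D) κ g ⟩
            κ * K * D + (1# - 1#) * κ * g
              ≈⟨ +-congˡ (*-congʳ (*-congʳ (+-congʳ 2h≈1))) ⟨
            κ * K * D + ((1# + 1#) * h - 1#) * κ * g
              ≈⟨ solve 4 (λ x κ g h → x :+ ((:1 :+ :1) :* h :- :1) :* κ :* g :=
                   h :* (x :+ κ :* g) :+ (:1 :- h) :* (x :+ κ :* (:0 :* g :+ (:- :1) :* g))) refl
                   (κ * K * D) κ g h ⟩
            h * (κ * K * D + κ * g) + (1# - h) * (κ * K * D + κ * (0# * g + - 1# * g))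
              ≈⟨ +-cong (*-congˡ (gram-lin (κ * K) κ δ G s e))
                   (*-congˡ (trans (gram-lin (κ * K) κ δ G⁻ s e)
                     (+-congˡ (*-congˡ (gram-lin 0# (- 1#) G G s e))))) ⟨
            mix h X⁺ X⁻ e ∎
            where
            D = gram δ s e
            g = gram G s e

          halve : (∃ λ h → 0# < h × (1# + 1#) * h ≈ 1#) → X⁺ ∈ cutHull s
          halve (h , 0<h , 2h≈1) = proj₁ (IsFace.extreme face X⁺ X⁻ h
            (perturbed∈elliptope (<⇒≤ 0<κ) κKr≈1 symmetric diagonal≈0 bound⁺) X⁻∈E
            0<h
            (0<-⇒< (<-respʳ (trans (solve 1 (λ h → h := (:1 :+ :1) :* h :- h) refl h) (+-congʳ 2h≈1)) 0<h))
            (hull-resp (range O) (centre≋mix 2h≈1) centre))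

        -- A point of the hull is `S D Sᵗ` with `D` diagonal. The dual family reads zero off it at
        -- distinct indices, but `κ * G i j` off the perturbed centroid.
        mixed-0 : ∀ i j → i ≢ j → G i j ≈ 0#
        mixed-0 i j i≢j = read-off (hull-coefficients {p = O} perturbed∈face)
          where
          read-off : (∃ λ d → (∀ i → 0# ≤ d i) × sum d ≈ 1# × gram (perturbed κ K G) s ≋ combination d O) →
            G i j ≈ 0#
          read-off (d , _ , _ , X≋dO) = *-cancelˡ-0 (λ κ≈0 → <⇒≉ 0<κ (sym κ≈0)) (begin
            κ * G i j
              ≈⟨ trans (+-congʳ (trans (*-congˡ (δ-≢ i≢j)) (zeroʳ _))) (+-identityˡ _) ⟨
            perturbed κ K G i j
              ≈⟨ bilinear-gram-dual s dual (perturbed κ K G) i j ⟨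
            bilinear (gram (perturbed κ K G) s) (w i) (w j)
              ≈⟨ bilinear-cong (λ e → trans (X≋dO e) (sym (diagonal e))) (w i) (w j) ⟩
            bilinear (gram D s) (w i) (w j)
              ≈⟨ bilinear-gram-dual s dual D i j ⟩
            δ i j * d i
              ≈⟨ trans (*-congʳ (δ-≢ i≢j)) (zeroˡ _) ⟩
            0# ∎)
            where
            D : Fin r → Fin r → Carrier
            D i j = δ i j * d i

            diagonal : gram D s ≋ combination d O
            diagonal e = trans (diagonal-gram s (λ i j i≢j → trans (*-congʳ (δ-≢ i≢j)) (zeroˡ _)) e)
              (combination-congˡ O (λ i → trans (*-congʳ (δ-refl i)) (*-identityˡ (d i))) e)

      face⇒mixed-0 : Fin r → ∀ i j → i ≢ j → G i j ≈ 0#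
      face⇒mixed-0 k = scale (form-bounded-below G) (form-bounded-below G⁻)
        where
        BoundedBelow : (Fin r → Fin r → Carrier) → Set
        BoundedBelow G = ∃ λ K → 0# < K × (∀ y →
          0# ≤ K * (y · y) + ∑[ i < r ] ∑[ j < r ] (G i j * (y i * y j)))

        0<r : 0# < sum {r} (λ _ → 1#)
        0<r = <-≤-trans 0<1 (term≤sum {r} {λ _ → 1#} (λ _ → <⇒≤ 0<1) k)

        enlarge : ∀ {G K} L → 0# < L →
          (∀ y → 0# ≤ K * (y · y) + ∑[ i < r ] ∑[ j < r ] (G i j * (y i * y j))) →
          ∀ y → 0# ≤ (K + L) * (y · y) + ∑[ i < r ] ∑[ j < r ] (G i j * (y i * y j))
        enlarge {K = K} L 0<L bound y = ≤-respʳ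
          (solve 4 (λ K L Y Q → (K :* Y :+ Q) :+ L :* Y := (K :+ L) :* Y :+ Q) refl K L (y · y) _)
          (+-nonneg (bound y) (*-nonneg (<⇒≤ 0<L) (sum-nonneg (λ i → square-nonneg (y i)))))

        scale : BoundedBelow G → BoundedBelow G⁻ → ∀ i j → i ≢ j → G i j ≈ 0#
        -- `G` and its negative come with separate constants; their sum bounds both, and `κ` is the
        -- inverse of that sum times `r`.
        scale (K , 0<K , bound⁺) (L , 0<L , bound⁻) = conclude (positive-inverse (*-pos 0<K+L 0<r))
          where
          0<K+L : 0# < K + L
          0<K+L = +-pos 0<K (<⇒≤ 0<L)

          conclude : (∃ λ κ → 0# < κ × (K + L) * sum {r} (λ _ → 1#) * κ ≈ 1#) → ∀ i j → i ≢ j → G i j ≈ 0#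
          conclude (κ , 0<κ , [K+L]rκ≈1) = mixed-0 0<κ 0<K+L
            (trans (solve 3 (λ κ K R → κ :* K :* R := K :* R :* κ) refl κ (K + L) _) [K+L]rκ≈1)
            (enlarge {G} L 0<L bound⁺)
            (λ y → ≤-respʳ (+-congʳ (*-congʳ (+-comm L K))) (enlarge {G⁻} K 0<K bound⁻ y))

    -- Points of the elliptope are symmetric and `SchurFree` asks for the mixed terms in symmetrised
    -- form, so `B` is replaced by `B + Bᵗ`, whose relation on the diagonal is twice that of `B`.
    face⇒schurFree : Fin n → Fin r → SchurFree s
    face⇒schurFree a k B ΣΣ≈0 = trace , mixed
      where
      G : Fin r → Fin r → Carrier
      G i j = B i j + B j i

      G-diagonal : ∀ a → gram G s (a , a) ≈ 0#
      G-diagonal a = begin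
        gram G s (a , a)
          ≈⟨ sum-cong (λ i → sum-cong (λ j → *-congʳ {x = ⟦ s i ⟧ a * ⟦ s j ⟧ a}
               (+-cong (*-identityˡ (B i j)) (*-identityˡ (B j i))))) ⟨
        gram (λ i j → 1# * B i j + 1# * B j i) s (a , a)
          ≈⟨ gram-lin 1# 1# B (λ i j → B j i) s (a , a) ⟩
        1# * gram B s (a , a) + 1# * gram (λ i j → B j i) s (a , a)
          ≈⟨ +-congˡ (*-congˡ transposed) ⟩
        1# * gram B s (a , a) + 1# * gram B s (a , a)
          ≈⟨ trans (+-cong (*-congˡ (ΣΣ≈0 a)) (*-congˡ (ΣΣ≈0 a)))
               (solve 0 (:1 :* :0 :+ :1 :* :0 := :0) refl) ⟩
        0# ∎
        where
        transposed : gram (λ i j → B j i) s (a , a) ≈ gram B s (a , a)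
        transposed = trans (∑-comm (λ i j → B j i * (⟦ s i ⟧ a * ⟦ s j ⟧ a)))
          (sum-cong (λ j → sum-cong (λ i → *-congˡ {x = B j i} (*-comm (⟦ s i ⟧ a) (⟦ s j ⟧ a)))))

      mixed : ∀ i j → i ≢ j → G i j ≈ 0#
      mixed = face⇒mixed-0 (proj₂ (dual-family (signs s) (face⇒signs-independent a)))
        (λ i j → +-comm (B i j) (B j i)) G-diagonal k

      -- Once the mixed terms are gone, the relation at the coordinate `a` reduces to the trace,
      -- since every diagonal product is 1 there.
      trace : ∑[ i < r ] B i i ≈ 0#
      trace = begin
        ∑[ i < r ] B i i
          ≈⟨ trans (+-cong (*-identityʳ _) (sum-0 (λ t → trans (*-congʳ (mixed _ _ (pair-≢ r t))) (zeroˡ _)))) (+-identityʳ _) ⟨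
        combination (generator-coefficients s B) (generator s) a
          ≈⟨ schurProducts-sum s B a ⟨
        ∑[ i < r ] ∑[ j < r ] (B i j * schurProducts s (i , j) a)
          ≈⟨ ΣΣ≈0 a ⟩
        0# ∎

-- The hull sees a sign vector only up to sign, whereas Schur independence counts vectors: for an
-- antipodal pair the hull is a single vertex, but the products span one dimension instead of two.
-- Hence the extra hypothesis of the converse. Likewise, with `r` or `n` zero the products span
-- dimension 0, while the formula for a family with at most one member asks for 1.
theorem3p4 : (ℝ : RealNumbers) → let open Geometry ℝ in
    (n r : ℕ) .{{_ : NonZero n}} .{{_ : NonZero r}}
    (s : Fin r → SignVector n) → Injective _≡_ _≡_ s →
    (SchurIndependent s → IsSimplicialFace (Elliptope n) (cutHull s))
    × ((∀ i j → s i ≢ negate (s j)) →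
    IsSimplicialFace (Elliptope n) (cutHull s) → SchurIndependent s)
    × ((SchurIndependent s ⊎ IsSimplicialFace (Elliptope n) (cutHull s)) →
    (A : Matrix n) → A ∈ Elliptope n → A ∈ relint (cutHull s) →
    HasUniqueSignDecomposition A)
theorem3p4 ℝ n r s s-injective = toFace , toSchur ,
  λ { (inj₁ schur) A _ → relint-unique s (toFace schur) A
    ; (inj₂ face)  A _ → relint-unique s face A }
  where
  open Geometry ℝ
  open Elliptopes ℝ
  open SchurProducts ℝ
  open SchurFaces ℝ
  open SimplicialFaces ℝ
  open FacesSchur ℝ

  coordinate : Fin n
  coordinate = fromℕ< (>-nonZero⁻¹ n)

  member : Fin r
  member = fromℕ< (>-nonZero⁻¹ r)

  toFace : SchurIndependent s → IsSimplicialFace (Elliptope n) (cutHull s)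
  toFace schur = schurFree⇒simplicialFace s member (independent⇒free s schur)

  toSchur : (∀ i j → s i ≢ negate (s j)) → IsSimplicialFace (Elliptope n) (cutHull s) → SchurIndependent s
  toSchur s≢-s (face , k , p , p-independent , F≐) = free⇒independent s member
    (face⇒schurFree s face
      (outers-affinelyIndependent s face p p-independent F≐ outers-injective) coordinate member)
    where
    outers-injective : ∀ i j → outer (s i) ≋ outer (s j) → i ≡ j
    outers-injective i j e with outer-injective (s i) (s j) e
    ... | inj₁ same     = s-injective same
    ... | inj₂ opposite = contradiction opposite (s≢-s i j)
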